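{- Let $c\in\mathbb{Q}\setminus\{ -1\}$ and $f_{6,c}(x)=x^6+c$. Then $f_{6,c}$ has no rational point of exact period $2$.
   Context: A point $x$ has exact period $2$ for $f$ if $f(f(x))=x$ and $f(x)\neq x$. -}

module Defs where

open import Data.Rational using (ℚ; _+_; _*_)

f6 : ℚ → ℚ → ℚ
f6 c x = x * x * x * x * x * x + c

{-# OPTIONS --safe #-}

-- A point of exact period 2 gives x ≠ y with y = x⁶ + c and x = y⁶ + c, hence
-- (x + y)(x⁴ + x²y² + y⁴) = -1, or (X + Y)(X² + XY + Y²)(X² - XY + Y²) = N⁵ with X, Y coprime.
--
-- If 3 ∣ X + Y, then X² + XY + Y² = b⁵ and X² - XY + Y² = 3d⁵, and working mod 25 shows 5 ∣ X + Y.
-- Writing b = σ + δ, d = σ - δ, the identity 3(b⁵ - d⁵) = 2(X + Y)² makes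
-- σ⁴ + 50σ²ε² + 125ε⁴ a square, where δ = 5ε.
--
-- If 3 ∤ X + Y, all three factors are fifth powers, and working mod 25 shows that 5 divides X or Y,
-- say Y.  Then X⁴ + X²Y² + Y⁴ is a fifth power, so X² - Y²ω = (p + qω)⁵ in ℤ[ω].  Comparing the
-- coefficients of ω expresses Y² as a product of coprime factors, one of which makes
-- l⁴ - 150l²r² + 1125r⁴ a square, where q = 5r and l = 2p - q.
--
-- Both quartics define elliptic curves of rank 0, and descent via 2-isogeny gives ε = 0, resp. r = 0.

module Submission where

open import Defs
open import Algebra.Structures using (IsCommutativeRing)
import Algebra.Solver.Ring.NaturalCoefficients.Default as NaturalSolver
open import Data.Bool.Base using (Bool; true; false; T; _∧_; if_then_else_)
open import Data.Bool.Properties using (T-∧)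
open import Data.Empty using (⊥; ⊥-elim)
open import Data.Fin.Base using (Fin; zero; suc)
open import Data.Fin.Patterns
open import Data.List.Base using (List; _∷_; [])
open import Data.List.Relation.Unary.All as All using (All)
open import Data.Maybe.Base using (nothing)
open import Data.Nat.Base as ℕ using (ℕ; zero; suc)
open import Data.Nat.Coprimality as Coprimality using ()
import Data.Nat.Divisibility as ℕ
open import Data.Nat.Induction using (<-wellFounded)
open import Data.Nat.Primality using (Prime; prime?; prime⇒irreducible)
import Data.Nat.Properties as ℕ
open import Data.Nat.Tactic.RingSolver using () renaming (solve-∀ to ℕ-solve-∀)
open import Data.Product using (_×_; _,_; ∃; ∃₂; proj₁; proj₂)
open import Data.Sum using (_⊎_; inj₁; inj₂; [_,_]′)
open import Data.Unit.Base using (tt)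
open import Data.Vec.Base as Vec using (Vec; lookup; map)
open import Function.Base using (id)
open import Function.Bundles using (Equivalence)
open import Induction.WellFounded using (Acc; acc)
open import Relation.Binary.PropositionalEquality
open import Relation.Nullary using (¬_; Dec; yes; no; contradiction)
open import Relation.Nullary.Decidable using (False; toWitnessFalse; from-yes; dec⇒maybe)
import Tactic.RingSolver as Tactic
open import Tactic.RingSolver.Core.AlmostCommutativeRing
  using (AlmostCommutativeRing; fromCommutativeRing)

-- Coprimality in commutative rings

-- The excluded value c = -1 really has the 2-cycle 0, -1, so (0, -1) and (-1, 0) lie on the curve;
-- likewise X + Y = N = 0 solves the homogeneous equation. Congruences alone therefore cannot settle
-- either case, and each ends in a descent that only stops at the trivial point.
--
-- If 3 ∣ X + Y, the difference of the two quadratic fifth powers is a constant times a square. In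
-- the other case that difference is 2XY, which is no multiple of a square, so the argument does not
-- carry over. Instead the product of the two is read as the norm of X² - Y²ω, whose ω-coefficient
-- is again a square up to sign.
--
-- The prime 5 is brought in first because fifth powers of sums have inner coefficients divisible by
-- 5: once 5 divides the square, it divides δ or q, and after the powers of 5 are removed the
-- remaining cofactor is prime to ε or r.
--
-- The two quartics are the cases k = 1 and k = -3 of x⁴ + 50kx²z² + 125k²z⁴, quadratic twists of
-- each other by -3, so a single descent with parameter k serves both.

module Divisibility {A : Set} {add mul : A → A → A} {neg : A → A} {0# 1# : A}
  (isCommutativeRing : IsCommutativeRing _≡_ add mul neg 0# 1#) where

  private
    ring : AlmostCommutativeRing _ _
    ring = fromCommutativeRing (record { isCommutativeRing = isCommutativeRing }) (λ _ → nothing)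

  open IsCommutativeRing isCommutativeRing
    using (*-comm; *-assoc; *-identityˡ; +-identityˡ; +-identityʳ; zeroˡ; +-comm; -‿inverseʳ)
  open AlmostCommutativeRing ring using (_+_; _*_; -_; _^_)
  open NaturalSolver (AlmostCommutativeRing.commutativeSemiring ring) using (solve; _:=_; _:+_; _:*_)
  open ≡-Reasoning

  infix 4 _∣_

  record _∣_ (a b : A) : Set where
    constructor divides
    field
      quotient : A
      equality : b ≡ quotient * a

  ∣-refl : ∀ {a} → a ∣ a
  ∣-refl {a} = divides 1# (sym (*-identityˡ a))

  ∣-trans : ∀ {a b c} → a ∣ b → b ∣ c → a ∣ c
  ∣-trans {a} (divides p refl) (divides q refl) = divides (q * p) (sym (*-assoc q p a))

  ∣-*ˡ : ∀ {a b} c → a ∣ b → a ∣ c * b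
  ∣-*ˡ {a} c (divides q refl) = divides (c * q) (sym (*-assoc c q a))

  ∣-+ : ∀ {a b c} → a ∣ b → a ∣ c → a ∣ b + c
  ∣-+ {a} (divides p refl) (divides q refl) = divides (p + q)
    (solve 3 (λ p q a → p :* a :+ q :* a := (p :+ q) :* a) refl p q a)

  ∣-* : ∀ {a b c d} → a ∣ b → c ∣ d → a * c ∣ b * d
  ∣-* {a} {c = c} (divides p refl) (divides q refl) = divides (p * q)
    (solve 4 (λ p q a c → (p :* a) :* (q :* c) := (p :* q) :* (a :* c)) refl p q a c)

  ∣-^ : ∀ {a b} n → a ∣ b → a ^ suc n ∣ b ^ suc n
  ∣-^ zero    a∣b = a∣b
  ∣-^ (suc n) a∣b = ∣-* (∣-^ n a∣b) a∣b

  -- A Bézout certificate rather than a condition on common divisors: it makes sense in every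
  -- commutative ring, so ℤ and ℤ[ω] share these lemmas, and coprimality of polynomial values
  -- becomes a matter of ring identities.
  record Coprime (a b : A) : Set where
    constructor coprime
    field
      u v      : A
      identity : u * a + v * b ≡ 1#

  coprime-sym : ∀ {a b} → Coprime a b → Coprime b a
  coprime-sym (coprime u v eq) = coprime v u (trans (+-comm _ _) eq)

  coprime-1 : ∀ {a} → Coprime a 1#
  coprime-1 {a} = coprime 0# 1# (trans (cong₂ _+_ (zeroˡ a) (*-identityˡ 1#)) (+-identityˡ 1#))

  coprime-∣ʳ : ∀ {a b c} → c ∣ b → Coprime a b → Coprime a c
  coprime-∣ʳ {a} {c = c} (divides q refl) (coprime u v eq) =
    coprime u (v * q) (trans (cong ((u * a) +_) (*-assoc v q c)) eq)

  coprime-∣ : ∀ {a b c d} → c ∣ a → d ∣ b → Coprime a b → Coprime c d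
  coprime-∣ c∣a d∣b co = coprime-sym (coprime-∣ʳ c∣a (coprime-sym (coprime-∣ʳ d∣b co)))

  coprime-* : ∀ {a b c} → Coprime a b → Coprime a c → Coprime a (b * c)
  coprime-* {a} {b} {c} (coprime u v eq) (coprime u′ v′ eq′) =
    -- The product of the two Bézout identities: three of its four terms contain `a`, and the last
    -- is `v * v′` times `b * c`.
    coprime (u * u′ * a + (u * (v′ * c) + v * b * u′)) (v * v′)
      (trans
        (solve 7 (λ a b c u v u′ v′ →
            (u :* u′ :* a :+ (u :* (v′ :* c) :+ v :* b :* u′)) :* a :+ v :* v′ :* (b :* c)
              := (u :* a :+ v :* b) :* (u′ :* a :+ v′ :* c)) refl a b c u v u′ v′)
        (trans (cong₂ _*_ eq eq′) (*-identityˡ 1#)))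

  coprime-^ : ∀ {a b} n → Coprime a b → Coprime a (b ^ suc n)
  coprime-^ zero    co = co
  coprime-^ (suc n) co = coprime-* (coprime-^ n co) co

  cancel-middle : ∀ x a b → (x + - x) * a + b ≡ b
  cancel-middle x a b = trans (cong (λ y → y * a + b) (-‿inverseʳ x))
    (trans (cong (_+ b) (zeroˡ a)) (+-identityˡ b))

  coprime-+ : ∀ {a b} t → Coprime a b → Coprime (a + t * b) b
  coprime-+ {a} {b} t (coprime u v eq) = coprime u (v + - (u * t))
    (trans (solve 6 (λ a b t u v n → u :* (a :+ t :* b) :+ (v :+ n) :* b
                      := (u :* t :+ n) :* b :+ (u :* a :+ v :* b)) refl a b t u v (- (u * t)))
      (trans (cancel-middle (u * t) b _) eq))

  coprime-divisor : ∀ {a b c} → Coprime a b → a ∣ b * c → a ∣ c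
  coprime-divisor {a} {b} {c} (coprime u v eq) (divides q bc≡qa) = divides (u * c + v * q) (begin
    c                           ≡⟨ *-identityˡ c ⟨
    1# * c                      ≡⟨ cong (_* c) eq ⟨
    (u * a + v * b) * c         ≡⟨ solve 5 (λ a b c u v → (u :* a :+ v :* b) :* c
                                     := u :* c :* a :+ v :* (b :* c)) refl a b c u v ⟩
    u * c * a + v * (b * c)     ≡⟨ cong (λ x → u * c * a + v * x) bc≡qa ⟩
    u * c * a + v * (q * a)     ≡⟨ solve 5 (λ a c u v q → u :* c :* a :+ v :* (q :* a)
                                     := (u :* c :+ v :* q) :* a) refl a c u v q ⟩
    (u * c + v * q) * a         ∎)

  record GCD (a b : A) : Set where
    constructor gcd
    field
      g        : A
      g∣a      : g ∣ a
      g∣b      : g ∣ b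
      u v      : A
      identity : u * a + v * b ≡ g

  ^-mod : ∀ a u x n → ∃ λ q → (u * a + x) ^ suc n ≡ q * a + x ^ suc n
  ^-mod a u x zero    = u , refl
  ^-mod a u x (suc n) with q , eq ← ^-mod a u x n = _ ,
    trans (cong (_* (u * a + x)) eq)
      (solve 5 (λ a u x q y → (q :* a :+ y) :* (u :* a :+ x)
        := (q :* (u :* a :+ x) :+ y :* u) :* a :+ y :* x) refl a u x q (x ^ suc n))

  *-^-distrib : ∀ a b n → (a * b) ^ suc n ≡ a ^ suc n * b ^ suc n
  *-^-distrib a b zero    = refl
  *-^-distrib a b (suc n) = trans (cong (_* (a * b)) (*-^-distrib a b n))
    (solve 4 (λ a b x y → (x :* y) :* (a :* b) := (x :* a) :* (y :* b)) refl
      a b (a ^ suc n) (b ^ suc n))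

  -- The ideal (a , c)ⁿ equals a (aⁿ⁻¹ , b) = (a), since cⁿ = a b.
  coprime-factor-power : ∀ {a b c} n → Coprime a b → a * b ≡ c ^ suc n → (d : GCD a c) →
    GCD.g d ^ suc n ∣ a × a ∣ GCD.g d ^ suc n
  coprime-factor-power {a} {b} {c} n co ab≡cⁿ (gcd g g∣a g∣c u v identity) = gⁿ∣a n refl , a∣gⁿ
    where
    a∣gⁿ : a ∣ g ^ suc n
    a∣gⁿ with q , eq ← ^-mod a u (v * c) n = divides (q + v ^ suc n * b) (begin
      g ^ suc n                          ≡⟨ cong (_^ suc n) identity ⟨
      (u * a + v * c) ^ suc n            ≡⟨ eq ⟩
      q * a + (v * c) ^ suc n            ≡⟨ cong ((q * a) +_) (*-^-distrib v c n) ⟩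
      q * a + v ^ suc n * c ^ suc n      ≡⟨ cong (λ x → q * a + v ^ suc n * x) ab≡cⁿ ⟨
      q * a + v ^ suc n * (a * b)        ≡⟨ solve 4 (λ a b q x → q :* a :+ x :* (a :* b)
                                              := (q :+ x :* b) :* a) refl a b q (v ^ suc n) ⟩
      (q + v ^ suc n * b) * a            ∎)

    gⁿ∣a : ∀ m → m ≡ n → g ^ suc n ∣ a
    gⁿ∣a zero    refl = g∣a
    gⁿ∣a (suc m) refl with coprime s t eq ← coprime-sym (coprime-^ m (coprime-sym co)) =
      subst (g ^ suc n ∣_) (begin
        s * a ^ suc n + t * c ^ suc n         ≡⟨ cong (λ x → s * a ^ suc n + t * x) ab≡cⁿ ⟨
        s * (a ^ suc m * a) + t * (a * b)     ≡⟨ solve 5 (λ a b s t x → s :* (x :* a) :+ t :* (a :* b)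
                                                   := (s :* x :+ t :* b) :* a) refl
                                                   a b s t (a ^ suc m) ⟩
        (s * a ^ suc m + t * b) * a           ≡⟨ cong (_* a) eq ⟩
        1# * a                                ≡⟨ *-identityˡ a ⟩
        a                                     ∎)
        (∣-+ (∣-*ˡ s (∣-^ n g∣a)) (∣-*ˡ t (∣-^ n g∣c)))

  module Euclidean (size : A → ℕ) (_≟0 : ∀ a → Dec (a ≡ 0#))
    (divide : ∀ a b → b ≢ 0# → ∃₂ λ q r → a ≡ q * b + r × size r ℕ.< size b) where

    bezout : ∀ a b → GCD a b
    bezout a b = go a b (<-wellFounded (size b))
      where
      go : ∀ a b → Acc ℕ._<_ (size b) → GCD a b
      go a b (acc rec) with b ≟0
      ... | yes refl = gcd a ∣-refl (divides 0# (sym (zeroˡ a))) 1# 0#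
                         (trans (cong₂ _+_ (*-identityˡ a) (zeroˡ 0#)) (+-identityʳ a))
      ... | no b≢0 with divide a b b≢0
      ...   | q , r , refl , r<b with go b r (rec r<b)
      ...     | gcd g g∣b g∣r u v identity =
        gcd g (∣-+ (∣-*ˡ q g∣b) g∣r) g∣b v (u + - (v * q))
          (trans (solve 6 (λ b q r u v n → v :* (q :* b :+ r) :+ (u :+ n) :* b
                             := (v :* q :+ n) :* b :+ (u :* b :+ v :* r)) refl b q r u v (- (v * q)))
            (trans (cancel-middle (v * q) b _) identity))

-- Divisibility, primes and coprime powers in the integers

open import Data.Integer.Base as ℤ
  using (ℤ; +_; +0; +[1+_]; -[1+_]; 0ℤ; 1ℤ; -1ℤ; _+_; _*_; -_; _-_) renaming (∣_∣ to abs)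
import Data.Integer.DivMod as ℤ
import Data.Integer.Properties as ℤ
open import Data.Integer.Tactic.RingSolver using (solve; solve-∀; ring)
open AlmostCommutativeRing ring using (_^_)
open import Tactic.RingSolver.NonReflective ring
  using (Expr; Κ; Ι; _⊕_; _⊗_; ⊝_; _⊛_; module Ops)
open Ops using (⟦_⟧)

open Divisibility ℤ.+-*-isCommutativeRing

-- Certificate of a linear combination: once the coefficient `c` of the hypothesis is supplied, what
-- remains is a polynomial identity for the ring solver.
linear₁ : ∀ {a b p q} c → p ≡ q → a - b ≡ c * (p - q) → a ≡ b
linear₁ {a} {b} {p} c refl eq = ℤ.i-j≡0⇒i≡j a b (trans eq
  (trans (cong (c *_) (ℤ.+-inverseʳ p)) (ℤ.*-zeroʳ c)))

linear₂ : ∀ {a b p q p′ q′} c c′ → p ≡ q → p′ ≡ q′ →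
  a - b ≡ c * (p - q) + c′ * (p′ - q′) → a ≡ b
linear₂ {p = p} {q} {p′} c c′ p≡q refl eq = linear₁ c p≡q (trans eq
  (trans (cong (λ x → c * (p - q) + c′ * x) (ℤ.+-inverseʳ p′))
    (trans (cong (λ x → c * (p - q) + x) (ℤ.*-zeroʳ c′)) (ℤ.+-identityʳ _))))

divideℤ : ∀ a b → b ≢ 0ℤ → ∃₂ λ q r → a ≡ q * b + r × abs r ℕ.< abs b
divideℤ a b b≢0 = a ℤ./ b , + (a ℤ.% b) ,
  trans (ℤ.a≡a%n+[a/n]*n a b) (ℤ.+-comm (+ (a ℤ.% b)) (a ℤ./ b * b)) , ℤ.n%d<d a b
  where instance _ = ℤ.≢-nonZero b≢0

abstract
  bezoutℤ : ∀ a b → GCD a b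
  bezoutℤ = Euclidean.bezout abs (ℤ._≟ 0ℤ) divideℤ

≡0⊎≡0 : ∀ a b → a * b ≡ 0ℤ → a ≡ 0ℤ ⊎ b ≡ 0ℤ
≡0⊎≡0 a b = ℤ.i*j≡0⇒i≡0∨j≡0 a

≢0-* : ∀ a b → a ≢ 0ℤ → b ≢ 0ℤ → a * b ≢ 0ℤ
≢0-* a b a≢0 b≢0 ab≡0 = [ a≢0 , b≢0 ]′ (ℤ.i*j≡0⇒i≡0∨j≡0 a ab≡0)

cancel : ∀ a {b c} → a ≢ 0ℤ → a * b ≡ a * c → b ≡ c
cancel a a≢0 = ℤ.*-cancelˡ-≡ a _ _ ⦃ ℤ.≢-nonZero a≢0 ⦄

∣⇒abs-∣ : ∀ {a b} → a ∣ b → abs a ℕ.∣ abs b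
∣⇒abs-∣ {a} (divides q refl) = ℕ.divides (abs q) (ℤ.abs-* q a)

square-≡ : ∀ a b → a ^ 2 ≡ b ^ 2 → a ≡ b ⊎ a ≡ - b
square-≡ a b eq with ≡0⊎≡0 (a - b) (a + b)
  (linear₁ 1ℤ eq (solve (a ∷ b ∷ [])))
... | inj₁ a-b≡0 = inj₁ (ℤ.i-j≡0⇒i≡j a b a-b≡0)
... | inj₂ a+b≡0 = inj₂ (linear₁ 1ℤ a+b≡0 (solve (a ∷ b ∷ [])))

abs-≡⇒≡± : ∀ a b → abs a ≡ abs b → a ≡ b ⊎ a ≡ - b
abs-≡⇒≡± (+ _)     (+ _)     refl = inj₁ refl
abs-≡⇒≡± (+ _)     -[1+ _ ]  refl = inj₂ refl
abs-≡⇒≡± -[1+ _ ]  (+ suc _) refl = inj₂ refl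
abs-≡⇒≡± -[1+ _ ]  -[1+ _ ]  refl = inj₁ refl

associates : ∀ a b → a ∣ b → b ∣ a → a ≡ b ⊎ a ≡ - b
associates a b a∣b b∣a = abs-≡⇒≡± a b (ℕ.∣-antisym (∣⇒abs-∣ {a} a∣b) (∣⇒abs-∣ {b} b∣a))

coprime-power : ∀ {a b} c n → Coprime a b → a * b ≡ c ^ suc n →
  ∃ λ g → a ≡ g ^ suc n ⊎ a ≡ - (g ^ suc n)
coprime-power {a} c n co eq = let g∣a , a∣g = coprime-factor-power n co eq (bezoutℤ a c)
  in _ , associates a _ a∣g g∣a

neg-fifth : ∀ g → - (g ^ 5) ≡ (- g) ^ 5
neg-fifth = solve-∀

-- Since -1 is a fifth power, the sign left over from the units of ℤ is absorbed into the root.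
coprime-fifth-power : ∀ {a b} c → Coprime a b → a * b ≡ c ^ 5 → ∃ λ g → a ≡ g ^ 5
coprime-fifth-power {a} {b} c co eq = fifth (coprime-power c 4 co eq)
  where
  fifth : (∃ λ g → a ≡ g ^ 5 ⊎ a ≡ - (g ^ 5)) → ∃ λ g → a ≡ g ^ 5
  fifth (g , inj₁ a≡g⁵)  = g , a≡g⁵
  fifth (g , inj₂ a≡-g⁵) = - g , trans a≡-g⁵ (neg-fifth g)

negate-identity : ∀ u v a b → - u * a + - v * b - 1ℤ ≡ -1ℤ * (u * a + v * b - -1ℤ)
negate-identity = solve-∀

-- Holds for 1 as well as for primes.
IsPrimeLike : ℤ → Set
IsPrimeLike q = ∀ a → q ∣ a ⊎ Coprime a q

prime-dichotomy : ∀ {p} → Prime p → IsPrimeLike (+ p)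
prime-dichotomy {p} pp a with bezoutℤ a (+ p)
... | gcd g g∣a g∣p u v identity with prime⇒irreducible pp (∣⇒abs-∣ {g} g∣p)
...   | inj₁ |g|≡1 with abs-≡⇒≡± g 1ℤ |g|≡1
...     | inj₁ refl = inj₂ (coprime u v identity)
...     | inj₂ refl = inj₂ (coprime (- u) (- v) (linear₁ -1ℤ identity (negate-identity u v a (+ p))))
prime-dichotomy {p} pp a | gcd g g∣a g∣p u v identity | inj₂ |g|≡p with abs-≡⇒≡± g (+ p) |g|≡p
... | inj₁ refl = inj₁ g∣a
... | inj₂ refl = inj₁ (∣-trans (divides -1ℤ (neg (+ p))) g∣a)
  where
  neg : ∀ x → - x ≡ -1ℤ * x
  neg = solve-∀

square-nonneg : ∀ a → 0ℤ ℤ.≤ a ^ 2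
square-nonneg (+ n)    = subst (0ℤ ℤ.≤_) (ℤ.pos-* n n) (ℤ.+≤+ ℕ.z≤n)
square-nonneg -[1+ n ] = ℤ.+≤+ ℕ.z≤n

nonneg-sum : ∀ {a b} → 0ℤ ℤ.≤ a → 0ℤ ℤ.≤ b → a + b ≡ 0ℤ → a ≡ 0ℤ
nonneg-sum {a} {b} 0≤a 0≤b eq =
  ℤ.≤-antisym (subst₂ ℤ._≤_ (ℤ.+-identityʳ a) eq (ℤ.+-monoʳ-≤ a {0ℤ} {b} 0≤b)) 0≤a

-- Polynomial congruences by exhausting residues

module Modular (m : ℕ) .{{_ : ℕ.NonZero m}} where

  allBelow : ℕ → (ℕ → Bool) → Bool
  allBelow zero    f = true
  allBelow (suc n) f = f n ∧ allBelow n f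

  allBelow-sound : ∀ n f → T (allBelow n f) → ∀ {r} → r ℕ.< n → T (f r)
  allBelow-sound (suc n) f ok {r} r<1+n with Equivalence.to T-∧ ok | ℕ.m≤n⇒m<n∨m≡n (ℕ.s≤s⁻¹ r<1+n)
  ... | fn , rest | inj₁ r<n  = allBelow-sound n f rest r<n
  ... | fn , rest | inj₂ refl = fn

  residue : ℤ → ℤ
  residue x = + (x ℤ.%ℕ m)

  allResidues : ∀ n → (Vec ℤ n → Bool) → Bool
  allResidues zero    f = f Vec.[]
  allResidues (suc n) f = allBelow m (λ r → allResidues n (λ ρ → f (+ r Vec.∷ ρ)))

  allResidues-sound : ∀ n f → T (allResidues n f) → ∀ ρ → T (f (map residue ρ))
  allResidues-sound zero    f ok Vec.[]      = ok
  allResidues-sound (suc n) f ok (x Vec.∷ ρ) = allResidues-sound n (λ σ → f (residue x Vec.∷ σ))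
    (allBelow-sound m (λ r → allResidues n (λ σ → f (+ r Vec.∷ σ))) ok (ℤ.n%ℕd<d x m)) ρ

  _≈_ : ℤ → ℤ → Set
  x ≈ y = + m ∣ (x - y)

  residue-≈ : ∀ x → x ≈ residue x
  residue-≈ x = divides (x ℤ./ℕ m) (linear₁ 1ℤ (ℤ.a≡a%ℕn+[a/ℕn]*n x m) (lemma x (residue x) (x ℤ./ℕ m) (+ m)))
    where
    lemma : ∀ x r q m → x - r - q * m ≡ 1ℤ * (x - (r + q * m))
    lemma = solve-∀

  ≈-refl : ∀ x → x ≈ x
  ≈-refl x = divides 0ℤ (ℤ.+-inverseʳ x)

  ≈-* : ∀ x y z w → x ≈ y → z ≈ w → (x * z) ≈ (y * w)
  ≈-* x y z w p q = subst (+ m ∣_) (lemma x y z w) (∣-+ (∣-*ˡ z p) (∣-*ˡ y q))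
    where
    lemma : ∀ x y z w → z * (x - y) + y * (z - w) ≡ x * z - y * w
    lemma = solve-∀

  ≈-^ : ∀ x y n → x ≈ y → (x ^ n) ≈ (y ^ n)
  ≈-^ x y zero          p = ≈-refl 1ℤ
  ≈-^ x y (suc zero)    p = p
  ≈-^ x y (suc (suc n)) p = ≈-* (x ^ suc n) (y ^ suc n) x y (≈-^ x y (suc n) p) p

  ⟦_⟧-≈ : ∀ {n} (e : Expr ℤ n) ρ → ⟦ e ⟧ ρ ≈ ⟦ e ⟧ (map residue ρ)
  ⟦ Κ x ⟧-≈   ρ = ≈-refl x
  ⟦ Ι i ⟧-≈   ρ = var i ρ
    where
    var : ∀ {n} (i : Fin n) ρ → lookup ρ i ≈ lookup (map residue ρ) i
    var zero    (x Vec.∷ ρ) = residue-≈ x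
    var (suc i) (x Vec.∷ ρ) = var i ρ
  ⟦ e ⊕ f ⟧-≈ ρ = subst (+ m ∣_)
    (lemma (⟦ e ⟧ ρ) (⟦ e ⟧ (map residue ρ)) (⟦ f ⟧ ρ) (⟦ f ⟧ (map residue ρ)))
    (∣-+ (⟦ e ⟧-≈ ρ) (⟦ f ⟧-≈ ρ))
    where
    lemma : ∀ x y z w → (x - y) + (z - w) ≡ (x + z) - (y + w)
    lemma = solve-∀
  ⟦ e ⊗ f ⟧-≈ ρ = ≈-* (⟦ e ⟧ ρ) (⟦ e ⟧ (map residue ρ)) (⟦ f ⟧ ρ) (⟦ f ⟧ (map residue ρ)) (⟦ e ⟧-≈ ρ) (⟦ f ⟧-≈ ρ)
  ⟦ e ⊛ n ⟧-≈ ρ = ≈-^ (⟦ e ⟧ ρ) (⟦ e ⟧ (map residue ρ)) n (⟦ e ⟧-≈ ρ)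
  ⟦ ⊝ e ⟧-≈   ρ = subst (+ m ∣_) (lemma (⟦ e ⟧ ρ) (⟦ e ⟧ (map residue ρ))) (∣-*ˡ -1ℤ (⟦ e ⟧-≈ ρ))
    where
    lemma : ∀ x y → -1ℤ * (x - y) ≡ - x - - y
    lemma = solve-∀

  vanishes : ℤ → Bool
  vanishes x = (x ℤ.%ℕ m) ℕ.≡ᵇ 0

  follows : ∀ {n} → List (Expr ℤ n) → Expr ℤ n → Vec ℤ n → Bool
  follows []       c ρ = vanishes (⟦ c ⟧ ρ)
  follows (h ∷ hs) c ρ = if vanishes (⟦ h ⟧ ρ) then follows hs c ρ else true

  vanishes⇒∣ : ∀ x → T (vanishes x) → + m ∣ x
  vanishes⇒∣ x ok = divides (x ℤ./ℕ m) (trans (ℤ.a≡a%ℕn+[a/ℕn]*n x m)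
    (trans (cong (λ r → + r + x ℤ./ℕ m * + m) (ℕ.≡ᵇ⇒≡ (x ℤ.%ℕ m) 0 ok)) (ℤ.+-identityˡ (x ℤ./ℕ m * + m))))

  ∣⇒vanishes : ∀ x → + m ∣ x → vanishes x ≡ true
  ∣⇒vanishes x m∣x = T⇒≡ (ℕ.≡⇒≡ᵇ (x ℤ.%ℕ m) 0 r≡0)
    where
    T⇒≡ : ∀ {b} → T b → b ≡ true
    T⇒≡ {true} _ = refl
    m∣r : m ℕ.∣ (x ℤ.%ℕ m)
    m∣r = ∣⇒abs-∣ {+ m} (subst (+ m ∣_) (lemma x (residue x)) (∣-+ m∣x (∣-*ˡ -1ℤ (residue-≈ x))))
      where
      lemma : ∀ x y → x + -1ℤ * (x - y) ≡ y
      lemma = solve-∀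
    r≡0 : x ℤ.%ℕ m ≡ 0
    r≡0 with x ℤ.%ℕ m | m∣r | ℤ.n%ℕd<d x m
    ... | zero  | _     | _   = refl
    ... | suc r | m∣1+r | r<m = contradiction (ℕ.∣⇒≤ m∣1+r) (ℕ.<⇒≱ r<m)

  transport : ∀ x y → x ≈ y → + m ∣ x → + m ∣ y
  transport x y p m∣x = subst (+ m ∣_) (lemma x y) (∣-+ m∣x (∣-*ˡ -1ℤ p))
    where
    lemma : ∀ x y → x + -1ℤ * (x - y) ≡ y
    lemma = solve-∀

  transport⁻ : ∀ x y → x ≈ y → + m ∣ y → + m ∣ x
  transport⁻ x y p m∣y = subst (+ m ∣_) (lemma x y) (∣-+ m∣y p)
    where
    lemma : ∀ x y → y + (x - y) ≡ x
    lemma = solve-∀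

  follows-sound : ∀ {n} hs (c : Expr ℤ n) ρ → T (follows hs c (map residue ρ)) →
    All (λ h → + m ∣ ⟦ h ⟧ ρ) hs → + m ∣ ⟦ c ⟧ ρ
  follows-sound []       c ρ ok All.[]           =
    transport⁻ (⟦ c ⟧ ρ) (⟦ c ⟧ (map residue ρ)) (⟦ c ⟧-≈ ρ) (vanishes⇒∣ (⟦ c ⟧ (map residue ρ)) ok)
  follows-sound (h ∷ hs) c ρ ok (m∣h All.∷ ms) = follows-sound hs c ρ
    (subst (λ b → T (if b then follows hs c (map residue ρ) else true))
      (∣⇒vanishes (⟦ h ⟧ (map residue ρ))
        (transport (⟦ h ⟧ ρ) (⟦ h ⟧ (map residue ρ)) (⟦ h ⟧-≈ ρ) m∣h)) ok) ms

  -- Proof by evaluation over all mⁿ vectors of residues: when the implication holds, the `T`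
  -- argument computes to the unit type and is given as `tt`. Hypotheses and conclusion share the
  -- modulus `m`, so a weaker conclusion is scaled first and unscaled by `cancel-∣`: evenness of `a`
  -- is tested modulo 32 as the vanishing of 16a.
  modular : ∀ {n} hs (c : Expr ℤ n) → T (allResidues n (follows hs c)) → ∀ ρ →
    All (λ h → + m ∣ ⟦ h ⟧ ρ) hs → + m ∣ ⟦ c ⟧ ρ
  modular {n} hs c ok ρ = follows-sound hs c ρ (allResidues-sound n (follows hs c) ok ρ)

-- Coprime factorisations of a square or of a prime times a square

≢0-factorˡ : ∀ a b {c} → a * b ≡ c → c ≢ 0ℤ → a ≢ 0ℤ
≢0-factorˡ a b eq c≢0 refl = c≢0 (trans (sym eq) (ℤ.*-zeroˡ b))

≢0-factorʳ : ∀ a b {c} → a * b ≡ c → c ≢ 0ℤ → b ≢ 0ℤ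
≢0-factorʳ a b eq c≢0 refl = c≢0 (trans (sym eq) (ℤ.*-zeroʳ a))

square-≡0 : ∀ a → a ^ 2 ≡ 0ℤ → a ≡ 0ℤ
square-≡0 a eq = [ id , id ]′ (≡0⊎≡0 a a eq)

IsUnit : ℤ → Set
IsUnit η = η ≡ 1ℤ ⊎ η ≡ -1ℤ

-- One unit `η` serves both factors, because `u` and `v / q` multiply to a nonzero square. The sign
-- of `h` is normalised so that `g * h` is `w` itself; this lets the equation for the roots be split
-- again.
record Split (q u v w : ℤ) : Set where
  constructor split
  field
    η g h  : ℤ
    unit   : IsUnit η
    u-part : u ≡ η * g ^ 2
    v-part : v ≡ η * (q * h ^ 2)
    root   : g * h ≡ w

split-square : ∀ u v w → Coprime u v → w ≢ 0ℤ → u * v ≡ w ^ 2 → Split 1ℤ u v w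
split-square u v w co w≢0 eq =
  combine (coprime-power w 1 co eq) (coprime-power w 1 (coprime-sym co) (trans (ℤ.*-comm v u) eq))
  where
  oriented : ∀ η g h → IsUnit η → u ≡ η * g ^ 2 → v ≡ η * (1ℤ * h ^ 2) →
    g * h ≡ w ⊎ g * h ≡ - w → Split 1ℤ u v w
  oriented η g h un ueq veq (inj₁ gh) = split η g h un ueq veq gh
  oriented η g h un ueq veq (inj₂ gh) = split η g (- h) un ueq
    (trans veq (solve (η ∷ h ∷ []))) (linear₁ -1ℤ gh (solve (g ∷ h ∷ w ∷ [])))

  same : ∀ g h → g ^ 2 * h ^ 2 ≡ w ^ 2 → g * h ≡ w ⊎ g * h ≡ - w
  same g h eq′ = square-≡ (g * h) w (linear₁ 1ℤ eq′ (solve (g ∷ h ∷ w ∷ [])))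

  opposite : ∀ g h → g ^ 2 * h ^ 2 + w ^ 2 ≡ 0ℤ → w ≡ 0ℤ
  opposite g h eq′ = square-≡0 w (nonneg-sum (square-nonneg w) (square-nonneg (g * h))
    (linear₁ 1ℤ eq′ (solve (g ∷ h ∷ w ∷ []))))

  combine : (∃ λ g → u ≡ g ^ 2 ⊎ u ≡ - (g ^ 2)) → (∃ λ h → v ≡ h ^ 2 ⊎ v ≡ - (h ^ 2)) → Split 1ℤ u v w
  combine (g , inj₁ ueq) (h , inj₁ veq) = oriented 1ℤ g h (inj₁ refl)
    (trans ueq (solve (g ∷ []))) (trans veq (solve (h ∷ [])))
    (same g h (trans (sym (cong₂ _*_ ueq veq)) eq))
  combine (g , inj₂ ueq) (h , inj₂ veq) = oriented -1ℤ g h (inj₂ refl)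
    (trans ueq (solve (g ∷ []))) (trans veq (solve (h ∷ [])))
    (same g h (linear₁ 1ℤ (trans (sym (cong₂ _*_ ueq veq)) eq) (solve (g ∷ h ∷ w ∷ []))))
  combine (g , inj₁ ueq) (h , inj₂ veq) = contradiction
    (opposite g h (linear₁ -1ℤ (trans (sym (cong₂ _*_ ueq veq)) eq) (solve (g ∷ h ∷ w ∷ [])))) w≢0
  combine (g , inj₂ ueq) (h , inj₁ veq) = contradiction
    (opposite g h (linear₁ -1ℤ (trans (sym (cong₂ _*_ ueq veq)) eq) (solve (g ∷ h ∷ w ∷ [])))) w≢0

split-multiple : ∀ q → q ≢ 0ℤ → ∀ u v w → Coprime u v → w ≢ 0ℤ → u * v ≡ q * w ^ 2 → q ∣ v → Split q u v w
split-multiple q q≢0 u v w co w≢0 eq (divides v′ veq) = rescale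
  (split-square u v′ w (coprime-∣ʳ (divides q (trans veq (ℤ.*-comm v′ q))) co) w≢0
    (cancel q q≢0 (linear₂ 1ℤ (- u) eq veq (solve (q ∷ u ∷ v ∷ v′ ∷ w ∷ [])))))
  where
  rescale : Split 1ℤ u v′ w → Split q u v w
  rescale (split η g h un ueq v′eq gh) = split η g h un ueq
    (linear₂ 1ℤ q veq v′eq (solve (q ∷ v ∷ v′ ∷ η ∷ h ∷ []))) gh

split-prime : ∀ q → q ≢ 0ℤ → IsPrimeLike q → ∀ u v w → Coprime u v → w ≢ 0ℤ → u * v ≡ q * w ^ 2 →
  Split q u v w ⊎ Split q v u w
split-prime q q≢0 dichotomy u v w co w≢0 eq = [ q∣u , q⊥u ]′ (dichotomy u)
  where
  q∣u : q ∣ u → Split q u v w ⊎ Split q v u w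
  q∣u d = inj₂ (split-multiple q q≢0 v u w (coprime-sym co) w≢0 (trans (ℤ.*-comm v u) eq) d)
  q⊥u : Coprime u q → Split q u v w ⊎ Split q v u w
  q⊥u u⊥q = inj₁ (split-multiple q q≢0 u v w co w≢0 eq
    (coprime-divisor (coprime-sym u⊥q) (divides (w ^ 2) (trans eq (ℤ.*-comm q (w ^ 2))))))

2-prime-like : IsPrimeLike (+ 2)
2-prime-like = prime-dichotomy (from-yes (prime? 2))

3-prime-like : IsPrimeLike (+ 3)
3-prime-like = prime-dichotomy (from-yes (prime? 3))

5-prime-like : IsPrimeLike (+ 5)
5-prime-like = prime-dichotomy (from-yes (prime? 5))

unit-square : ∀ {η} → IsUnit η → η ^ 2 ≡ 1ℤ
unit-square (inj₁ refl) = refl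
unit-square (inj₂ refl) = refl

-- The shapes that r + s can take when r and s are coprime with product 125κ²z⁴. With `b` named as
-- the root in the term that carries 125, there remain a common sign and the choice of the term that
-- carries κ².
data Quartic (κ t z : ℤ) : Set where
  quartic₁ : ∀ η a b → IsUnit η → a * b ≡ z → Coprime a (+ 5 * κ * b) →
    t ≡ η * (a ^ 4 + + 125 * (κ ^ 2 * b ^ 4)) → Quartic κ t z
  quartic₂ : ∀ η a b → IsUnit η → a * b ≡ z → Coprime (κ * a) (+ 5 * b) →
    t ≡ η * (κ ^ 2 * a ^ 4 + + 125 * b ^ 4) → Quartic κ t z

module Factorisation (κ : ℤ) (κ≢0 : κ ≢ 0ℤ) (κ-prime : IsPrimeLike κ) where

  -- The product is 5 (5κz²)², so up to a common sign one factor is A² and the other 5B², with AB =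
  -- 5κz². As 5 cannot divide A, it divides B = 5B₁, and AB₁ = κz² is split a second time; the sign
  -- from this second splitting disappears on squaring.
  quartic-split : ∀ r s z → Coprime r s → z ≢ 0ℤ → r * s ≡ + 125 * (κ ^ 2 * z ^ 4) → Quartic κ (r + s) z
  quartic-split r s z co z≢0 eq =
    [ five r s co , (λ sp → subst (λ t → Quartic κ t z) (ℤ.+-comm s r) (five s r (coprime-sym co) sp)) ]′
    (split-prime (+ 5) (λ ()) 5-prime-like r s (+ 5 * κ * z ^ 2) co
      (≢0-* (+ 5 * κ) (z ^ 2) (≢0-* (+ 5) κ (λ ()) κ≢0) (≢0-* z z z≢0 z≢0))
      (linear₁ 1ℤ eq (solve (r ∷ s ∷ κ ∷ z ∷ []))))
    where
    five : ∀ r s → Coprime r s → Split (+ 5) r s (+ 5 * κ * z ^ 2) → Quartic κ (r + s) z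
    five r s co (split η A B un req seq AB) = with5 (coprime-divisor (coprime-sym A⊥5) 5∣AB)
      where
      A∣r : A ∣ r
      A∣r = divides (η * A) (trans req (solve (η ∷ A ∷ [])))
      A⊥5 : Coprime A (+ 5)
      A⊥5 = coprime-∣ A∣r (divides (η * B ^ 2) (trans seq (solve (η ∷ B ∷ [])))) co
      5∣AB : + 5 ∣ A * B
      5∣AB = divides (κ * z ^ 2) (trans AB (solve (κ ∷ z ∷ [])))
      with5 : + 5 ∣ B → Quartic κ (r + s) z
      with5 (divides B₁ Beq) = [ first , second ]′
        (split-prime κ κ≢0 κ-prime A B₁ z (coprime-∣ A∣r B₁∣s co) z≢0
          (cancel (+ 5) (λ ()) (linear₂ 1ℤ (- A) AB Beq (solve (κ ∷ z ∷ A ∷ B ∷ B₁ ∷ [])))))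
        where
        seq₁ : s ≡ η * (+ 125 * B₁ ^ 2)
        seq₁ = trans seq (trans (cong (λ x → η * (+ 5 * x ^ 2)) Beq) (solve (η ∷ B₁ ∷ [])))
        B₁∣s : B₁ ∣ s
        B₁∣s = divides (η * (+ 125 * B₁)) (trans seq₁ (solve (η ∷ B₁ ∷ [])))
        first : Split κ A B₁ z → Quartic κ (r + s) z
        first (split θ a b un′ Aeq B₁eq ab) = quartic₁ η a b un ab
          (coprime-∣ (divides (η * a ^ 3) (trans req₁ (solve (η ∷ a ∷ []))))
            (divides (η * (+ 25 * (κ * b ^ 3))) (trans seq₂ (solve (η ∷ κ ∷ b ∷ [])))) co)
          (trans (cong₂ _+_ req₁ seq₂) (solve (η ∷ κ ∷ a ∷ b ∷ [])))
          where
          req₁ : r ≡ η * a ^ 4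
          req₁ = trans req (trans (cong (λ x → η * x ^ 2) Aeq)
            (linear₁ (η * a ^ 4) (unit-square un′) (solve (η ∷ θ ∷ a ∷ []))))
          seq₂ : s ≡ η * (+ 125 * (κ ^ 2 * b ^ 4))
          seq₂ = trans seq₁ (trans (cong (λ x → η * (+ 125 * x ^ 2)) B₁eq)
            (linear₁ (η * (+ 125 * (κ ^ 2 * b ^ 4))) (unit-square un′) (solve (η ∷ θ ∷ κ ∷ b ∷ []))))
        second : Split κ B₁ A z → Quartic κ (r + s) z
        second (split θ b a un′ B₁eq Aeq ba) = quartic₂ η a b un (trans (ℤ.*-comm a b) ba)
          (coprime-∣ (divides (η * (κ * a ^ 3)) (trans req₁ (solve (η ∷ κ ∷ a ∷ []))))
            (divides (η * (+ 25 * b ^ 3)) (trans seq₂ (solve (η ∷ b ∷ [])))) co)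
          (trans (cong₂ _+_ req₁ seq₂) (solve (η ∷ κ ∷ a ∷ b ∷ [])))
          where
          req₁ : r ≡ η * (κ ^ 2 * a ^ 4)
          req₁ = trans req (trans (cong (λ x → η * x ^ 2) Aeq)
            (linear₁ (η * (κ ^ 2 * a ^ 4)) (unit-square un′) (solve (η ∷ θ ∷ κ ∷ a ∷ []))))
          seq₂ : s ≡ η * (+ 125 * b ^ 4)
          seq₂ = trans seq₁ (trans (cong (λ x → η * (+ 125 * x ^ 2)) B₁eq)
            (linear₁ (η * (+ 125 * b ^ 4)) (unit-square un′) (solve (η ∷ θ ∷ b ∷ []))))

-- Descent by 2-isogeny

coprime-from-sum : ∀ r s → Coprime (r + s) (r * s) → Coprime r s
coprime-from-sum r s co = subst (λ x → Coprime x s) (lemma r s)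
  (coprime-+ -1ℤ (coprime-∣ʳ (divides r refl) co))
  where
  lemma : ∀ r s → r + s + -1ℤ * s ≡ r
  lemma = solve-∀

module _ (κ : ℤ) (κ≢0 : κ ≢ 0ℤ) (κ-prime : IsPrimeLike κ) where

  open Factorisation κ κ≢0 κ-prime

  coprime-5κz : ∀ {m} z → Coprime m (+ 5 * κ * z) → Coprime m (+ 125 * (κ ^ 2 * z ^ 4))
  coprime-5κz z co = coprime-∣ʳ {b = (+ 5 * κ * z) ^ 4} (divides (+ 5 * κ ^ 2) (solve (κ ∷ z ∷ []))) (coprime-^ 3 co)

  -- m - y and m + y have the same parity and an even product, so both are even. Their halves
  -- multiply to 125κ²z⁴ and add up to m, which is prime to that product; hence the halves are
  -- coprime.
  difference-of-squares : ∀ m y z → z ≢ 0ℤ → Coprime m (+ 5 * κ * z) →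
    (m - y) * (m + y) ≡ + 500 * (κ ^ 2 * z ^ 4) → Quartic κ m z
  difference-of-squares m y z z≢0 co eq = halve ([ id , parity ]′ (2-prime-like (m - y)))
    where
    parity : Coprime (m - y) (+ 2) → + 2 ∣ m - y
    parity co′ = subst (+ 2 ∣_) {x = m + y + - y * + 2} (solve (m ∷ y ∷ []))
      (∣-+ (coprime-divisor {b = m - y} (coprime-sym co′)
        (divides (+ 250 * (κ ^ 2 * z ^ 4)) (trans eq (solve (κ ∷ z ∷ []))))) (divides (- y) refl))
    halve : + 2 ∣ m - y → Quartic κ m z
    halve (divides r req) = subst (λ t → Quartic κ t z) (sym m≡)
      (quartic-split r (r + y) z (coprime-from-sum r (r + y) (subst₂ Coprime m≡ (sym rs) (coprime-5κz z co))) z≢0 rs)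
      where
      m≡ : m ≡ r + (r + y)
      m≡ = linear₁ 1ℤ req (solve (m ∷ y ∷ r ∷ []))
      rs : r * (r + y) ≡ + 125 * (κ ^ 2 * z ^ 4)
      rs = cancel (+ 4) (λ ()) (linear₂ 1ℤ (- (m + y + + 2 * r)) eq req (solve (m ∷ y ∷ r ∷ κ ∷ z ∷ [])))

-- The factor 2 is what makes the descent strict, since `t` may be 1 or -1.
abs-decreases : ∀ {z} t f → + 2 * t * f ≡ z → z ≢ 0ℤ → abs f ℕ.< abs z
abs-decreases t f eq z≢0 = subst (abs f ℕ.<_)
  (trans (sym (trans (ℤ.abs-* (+ 2 * t) f) (cong (ℕ._* abs f) (ℤ.abs-* (+ 2) t)))) (cong abs eq))
  (begin-strict
    abs f                     <⟨ ℕ.m<m+n (abs f) (ℕ.n≢0⇒n>0 (λ f≡0 → f≢0 (ℤ.∣i∣≡0⇒i≡0 f≡0))) ⟩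
    abs f ℕ.+ abs f           ≡⟨ cong (abs f ℕ.+_) (ℕ.+-identityʳ (abs f)) ⟨
    2 ℕ.* abs f               ≤⟨ ℕ.*-monoˡ-≤ (abs f) (ℕ.*-monoʳ-≤ 2 (ℕ.n≢0⇒n>0 (λ t≡0 → t≢0 (ℤ.∣i∣≡0⇒i≡0 t≡0)))) ⟩
    2 ℕ.* abs t ℕ.* abs f     ∎)
  where
  open ℕ.≤-Reasoning
  f≢0 : f ≢ 0ℤ
  f≢0 = ≢0-factorʳ (+ 2 * t) f eq z≢0
  t≢0 : t ≢ 0ℤ
  t≢0 = ≢0-factorʳ (+ 2) t refl (≢0-factorˡ (+ 2 * t) f eq z≢0)

-- With k = ε κ, the curves y² = x⁴ + 50 k x² z² + 125 κ² z⁴ and x² = a⁴ - 25 k a² b² + 125 κ² b⁴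
-- are linked by 2-isogenies (the constant ±50 or ±25 is K below); Excludes says that every other
-- homogeneous space of the corresponding isogeny has no rational point with z ≠ 0.
Excludes : ℤ → ℤ → Set
Excludes κ K = ∀ x z → z ≢ 0ℤ → Quartic κ (x ^ 2 + K * z ^ 2) z → ∃₂ λ a b →
  a * b ≡ z × Coprime a (+ 5 * κ * b) ×
  x ^ 2 ≡ a ^ 4 - K * (a ^ 2 * b ^ 2) + + 125 * (κ ^ 2 * b ^ 4)

module Descent (ε κ : ℤ) (ε²≡1 : ε ^ 2 ≡ 1ℤ) (κ≢0 : κ ≢ 0ℤ) (κ-prime : IsPrimeLike κ)
  (κ-odd : Coprime κ (+ 2))
  (exclude₂₅ : Excludes κ (+ 25 * (ε * κ))) (exclude₋₅₀ : Excludes κ (-[1+ 49 ] * (ε * κ)))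
  (even : ∀ a c f → Coprime f (+ 2) →
    (+ 2 * a) ^ 2 ≡ c ^ 4 - -[1+ 49 ] * (ε * κ) * (c ^ 2 * f ^ 2) + + 125 * (κ ^ 2 * f ^ 4) → + 2 ∣ a)
  where

  open Factorisation κ κ≢0 κ-prime

  Solution : ℤ → Set
  Solution z = ∃₂ λ x y → Coprime x (+ 5 * κ * z) ×
    y ^ 2 ≡ x ^ 4 - -[1+ 49 ] * (ε * κ) * (x ^ 2 * z ^ 2) + + 125 * (κ ^ 2 * z ^ 4)

  -- One passage through the 2-isogeny and back through its dual. Completing the square gives y² =
  -- (x² + 25kz²)² - 500κ²z⁴ with k = εκ, which yields a point (a, b) with ab = z on the isogenous
  -- quartic; a second completion of the square returns to the original one.
  smaller : ∀ z → z ≢ 0ℤ → Solution z → ∃ λ z′ → abs z′ ℕ.< abs z × z′ ≢ 0ℤ × Solution z′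
  smaller z z≢0 (x , y , co , yeq) = step₁ (exclude₂₅ x z z≢0
    (difference-of-squares κ κ≢0 κ-prime (x ^ 2 + + 25 * (ε * κ) * z ^ 2) y z z≢0
      (subst (λ t → Coprime t (+ 5 * κ * z)) {x = x ^ 2 + (+ 5 * ε * z) * (+ 5 * κ * z)}
        (solve (x ∷ ε ∷ κ ∷ z ∷ []))
        (coprime-+ (+ 5 * ε * z) (coprime-sym (coprime-^ 1 (coprime-sym co)))))
      (linear₂ -1ℤ (+ 625 * (κ ^ 2 * z ^ 4)) yeq ε²≡1 (solve (x ∷ y ∷ z ∷ ε ∷ κ ∷ [])))))
    where
    Smaller : Set
    Smaller = ∃ λ z′ → abs z′ ℕ.< abs z × z′ ≢ 0ℤ × Solution z′
    step₁ : (∃₂ λ a b → a * b ≡ z × Coprime a (+ 5 * κ * b) ×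
      x ^ 2 ≡ a ^ 4 - + 25 * (ε * κ) * (a ^ 2 * b ^ 2) + + 125 * (κ ^ 2 * b ^ 4)) → Smaller
    step₁ (a , b , ab , a⊥ , xeq) = [ b-even , b-odd ]′ (2-prime-like b)
      where
      b≢0 : b ≢ 0ℤ
      b≢0 = ≢0-factorʳ a b ab z≢0
      a²⊥ : Coprime (a ^ 2) (+ 5 * κ * b)
      a²⊥ = coprime-sym (coprime-^ 1 (coprime-sym a⊥))
      -- For b = 2b₁ the isogenous quartic reads x² = (a² - 50kb₁²)² - 500κ²b₁⁴, again with the
      -- constant 500. The 2 in b supplies the strict decrease.
      b-even : + 2 ∣ b → Smaller
      b-even (divides b₁ beq) = step₂ (exclude₋₅₀ a b₁ b₁≢0
        (difference-of-squares κ κ≢0 κ-prime (a ^ 2 + -[1+ 49 ] * (ε * κ) * b₁ ^ 2) x b₁ b₁≢0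
          (subst (λ t → Coprime t (+ 5 * κ * b₁)) {x = a ^ 2 + (-[1+ 9 ] * ε * b₁) * (+ 5 * κ * b₁)}
            (solve (a ∷ ε ∷ κ ∷ b₁ ∷ []))
            (coprime-+ (-[1+ 9 ] * ε * b₁) (coprime-∣ʳ {b = + 5 * κ * b}
              (divides (+ 2) (trans (cong (+ 5 * κ *_) {y = b₁ * + 2} beq) (solve (κ ∷ b₁ ∷ [])))) a²⊥)))
          (linear₂ -1ℤ (+ 2500 * (κ ^ 2 * b₁ ^ 4))
            (trans xeq (cong (λ b → a ^ 4 - + 25 * (ε * κ) * (a ^ 2 * b ^ 2) + + 125 * (κ ^ 2 * b ^ 4)) {y = b₁ * + 2} beq))
            ε²≡1 (solve (a ∷ x ∷ b₁ ∷ ε ∷ κ ∷ [])))))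
        where
        b₁≢0 : b₁ ≢ 0ℤ
        b₁≢0 = ≢0-factorˡ b₁ (+ 2) (sym beq) b≢0
        step₂ : (∃₂ λ c f → c * f ≡ b₁ × Coprime c (+ 5 * κ * f) ×
          a ^ 2 ≡ c ^ 4 - -[1+ 49 ] * (ε * κ) * (c ^ 2 * f ^ 2) + + 125 * (κ ^ 2 * f ^ 4)) → Smaller
        step₂ (c , f , cf , c⊥ , aeq) = f ,
          abs-decreases (a * c) f (trans 2acf≡ab ab) z≢0 , ≢0-factorʳ c f cf b₁≢0 , c , a , c⊥ , aeq
          where
          2acf≡ab : + 2 * (a * c) * f ≡ a * b
          2acf≡ab = linear₂ (+ 2 * a) (- a) cf beq (solve (a ∷ b ∷ b₁ ∷ c ∷ f ∷ []))
      -- For odd b the equation must be multiplied by 4 to complete the square: n² - (2x)² = 125κ²b⁴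
      -- with n = 2a² - 25kb². Then r + s = 2n = (2a)² - 50kb², so 2a takes the place of a in the
      -- exclusion.
      b-odd : Coprime b (+ 2) → Smaller
      b-odd b⊥2 = step₂ (exclude₋₅₀ (+ 2 * a) b b≢0 (subst (λ t → Quartic κ t b) r+s
          (quartic-split r s b (coprime-from-sum r s
            (subst₂ Coprime {x = + 2 * n} 2n (sym rs) (coprime-5κz κ κ≢0 κ-prime b 2n⊥))) b≢0 rs)))
        where
        n r s : ℤ
        n = + 2 * a ^ 2 + (-[1+ 4 ] * ε * b) * (+ 5 * κ * b)
        r = n - + 2 * x
        s = n + + 2 * x
        rs : r * s ≡ + 125 * (κ ^ 2 * b ^ 4)
        rs = linear₂ -[1+ 3 ] (+ 625 * (κ ^ 2 * b ^ 4)) xeq ε²≡1 (lemma a b x ε κ)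
          where
          lemma : ∀ a b x ε κ →
            (+ 2 * a ^ 2 + (-[1+ 4 ] * ε * b) * (+ 5 * κ * b) - + 2 * x) *
            (+ 2 * a ^ 2 + (-[1+ 4 ] * ε * b) * (+ 5 * κ * b) + + 2 * x) - + 125 * (κ ^ 2 * b ^ 4) ≡
            -[1+ 3 ] * (x ^ 2 - (a ^ 4 - + 25 * (ε * κ) * (a ^ 2 * b ^ 2) + + 125 * (κ ^ 2 * b ^ 4))) +
            + 625 * (κ ^ 2 * b ^ 4) * (ε ^ 2 - 1ℤ)
          lemma = solve-∀
        2n : + 2 * n ≡ r + s
        2n = lemma n x
          where
          lemma : ∀ n x → + 2 * n ≡ n - + 2 * x + (n + + 2 * x)
          lemma = solve-∀
        r+s : r + s ≡ (+ 2 * a) ^ 2 + -[1+ 49 ] * (ε * κ) * b ^ 2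
        r+s = trans (sym 2n) (lemma a b ε κ)
          where
          lemma : ∀ a b ε κ → + 2 * (+ 2 * a ^ 2 + (-[1+ 4 ] * ε * b) * (+ 5 * κ * b)) ≡
            (+ 2 * a) ^ 2 + -[1+ 49 ] * (ε * κ) * b ^ 2
          lemma = solve-∀
        2⊥ : Coprime (+ 2) (+ 5 * κ * b)
        2⊥ = coprime-* (coprime-* {b = + 5} (coprime -[1+ 1 ] 1ℤ refl) (coprime-sym κ-odd)) (coprime-sym b⊥2)
        2n⊥ : Coprime (+ 2 * n) (+ 5 * κ * b)
        2n⊥ = coprime-sym (coprime-* (coprime-sym 2⊥) (coprime-sym
          (coprime-+ (-[1+ 4 ] * ε * b) (coprime-sym (coprime-* (coprime-sym 2⊥) (coprime-sym a²⊥))))))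
        step₂ : (∃₂ λ c f → c * f ≡ b × Coprime c (+ 5 * κ * f) ×
          (+ 2 * a) ^ 2 ≡ c ^ 4 - -[1+ 49 ] * (ε * κ) * (c ^ 2 * f ^ 2) + + 125 * (κ ^ 2 * f ^ 4)) → Smaller
        -- So far z = acf, which would allow f = ± z; evenness of a supplies the missing factor 2.
        step₂ (c , f , cf , c⊥ , aeq) = finish (even a c f (coprime-∣ (divides c (sym cf)) ∣-refl b⊥2) aeq)
          where
          finish : + 2 ∣ a → Smaller
          finish (divides a₁ a₁eq) = f , abs-decreases (a₁ * c) f (trans 2a₁cf≡ab ab) z≢0 ,
            ≢0-factorʳ c f cf b≢0 , c , + 2 * a , c⊥ , aeq
            where
            2a₁cf≡ab : + 2 * (a₁ * c) * f ≡ a * b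
            2a₁cf≡ab = linear₂ a (- (c * f)) cf a₁eq (solve (a ∷ a₁ ∷ b ∷ c ∷ f ∷ []))

  no-solution : ∀ z → Solution z → z ≡ 0ℤ
  no-solution z = go z (<-wellFounded (abs z))
    where
    go : ∀ z → Acc ℕ._<_ (abs z) → Solution z → z ≡ 0ℤ
    go z (acc rec) sol with z ℤ.≟ 0ℤ
    ... | yes z≡0 = z≡0
    ... | no  z≢0 = let z′ , z′<z , z′≢0 , sol′ = smaller z z≢0 sol
                    in contradiction (go z′ (rec z′<z) sol′) z′≢0

-- Local obstructions on the remaining homogeneous spaces

≡⇒∣ : ∀ {m a b} → a ≡ b → m ∣ a - b
≡⇒∣ eq = divides 0ℤ (ℤ.i≡j⇒i-j≡0 eq)

common-divisor : ∀ d {a b} → False (d ℕ.∣? 1) → Coprime a b → + d ∣ a → + d ∣ b → ⊥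
common-divisor d d∤1 (coprime u v identity) d∣a d∣b = toWitnessFalse d∤1
  (∣⇒abs-∣ {+ d} (subst (+ d ∣_) identity (∣-+ (∣-*ˡ u d∣a) (∣-*ˡ v d∣b))))

cancel-∣ : ∀ q {d a} → q ≢ 0ℤ → q * d ∣ q * a → d ∣ a
cancel-∣ q {d} {a} q≢0 (divides t eq) =
  divides t (cancel q q≢0 (trans eq (solve (t ∷ q ∷ d ∷ []))))

module _ (m : ℕ) .{{_ : ℕ.NonZero m}} (K s p q : ℤ) where

  torsor : Expr ℤ 3
  torsor = Ι 0F ⊛ 2 ⊕ Κ K ⊗ (Ι 1F ⊗ Ι 2F) ⊛ 2 ⊕ ⊝ (Κ s ⊗ (Κ p ⊗ Ι 1F ⊛ 4 ⊕ Κ q ⊗ Ι 2F ⊛ 4))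

  torsor-mod : ∀ c → T (Modular.allResidues m 3 (Modular.follows m (torsor ∷ []) c)) → ∀ x a b →
    x ^ 2 + K * (a * b) ^ 2 ≡ s * (p * a ^ 4 + q * b ^ 4) → + m ∣ Ops.⟦ c ⟧ (x Vec.∷ a Vec.∷ b Vec.∷ Vec.[])
  torsor-mod c ok x a b eq = Modular.modular m (torsor ∷ []) c ok _ (≡⇒∣ eq All.∷ All.[])

nonneg-* : ∀ k {a} → 0ℤ ℤ.≤ a → 0ℤ ℤ.≤ + k * a
nonneg-* k {+ n} _ = subst (0ℤ ℤ.≤_) (ℤ.pos-* k n) (ℤ.+≤+ ℕ.z≤n)

nonneg-+ : ∀ {a b} → 0ℤ ℤ.≤ a → 0ℤ ℤ.≤ b → 0ℤ ℤ.≤ a + b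
nonneg-+ = ℤ.+-mono-≤

-- A real obstruction: moved to one side, all terms are nonnegative, so the one with the positive
-- coefficient `suc p` vanishes.
definite : ∀ k p q x a b → + suc p ≢ 0ℤ →
  x ^ 2 + + k * (a * b) ^ 2 ≡ -1ℤ * (+ suc p * a ^ 4 + + q * b ^ 4) → a * b ≡ 0ℤ
definite k p q x a b p≢0 eq = subst (λ a → a * b ≡ 0ℤ) (sym a≡0) (ℤ.*-zeroˡ b)
  where
  sum≡0 : + suc p * (a ^ 2) ^ 2 + (x ^ 2 + (+ k * (a * b) ^ 2 + + q * (b ^ 2) ^ 2)) ≡ 0ℤ
  sum≡0 = linear₁ 1ℤ eq (lemma (+ suc p) (+ k) (+ q) x a b)
    where
    lemma : ∀ p k q x a b → p * (a ^ 2) ^ 2 + (x ^ 2 + (k * (a * b) ^ 2 + q * (b ^ 2) ^ 2)) - 0ℤ ≡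
      1ℤ * (x ^ 2 + k * (a * b) ^ 2 - -1ℤ * (p * a ^ 4 + q * b ^ 4))
    lemma = solve-∀
  pa⁴≡0 : + suc p * (a ^ 2) ^ 2 ≡ 0ℤ
  pa⁴≡0 = nonneg-sum (nonneg-* (suc p) (square-nonneg (a ^ 2)))
    (nonneg-+ (square-nonneg x) (nonneg-+ (nonneg-* k (square-nonneg (a * b))) (nonneg-* q (square-nonneg (b ^ 2)))))
    sum≡0
  a≡0 : a ≡ 0ℤ
  a≡0 = square-≡0 a (square-≡0 (a ^ 2) (cancel (+ suc p) p≢0 (trans pa⁴≡0 (sym (ℤ.*-zeroʳ (+ suc p))))))

module _ (κ K : ℤ)
  (negative₁ : ∀ x a b → Coprime a (+ 5 * κ * b) →
    x ^ 2 + K * (a * b) ^ 2 ≡ -1ℤ * (1ℤ * a ^ 4 + + 125 * κ ^ 2 * b ^ 4) → a * b ≡ 0ℤ) where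

  excludes₁ : ∀ η x a b → IsUnit η → a * b ≢ 0ℤ → Coprime a (+ 5 * κ * b) →
    x ^ 2 + K * (a * b) ^ 2 ≡ η * (a ^ 4 + + 125 * (κ ^ 2 * b ^ 4)) →
    ∃₂ λ c d → c * d ≡ a * b × Coprime c (+ 5 * κ * d) ×
      x ^ 2 ≡ c ^ 4 - K * (c ^ 2 * d ^ 2) + + 125 * (κ ^ 2 * d ^ 4)
  excludes₁ η x a b (inj₁ refl) ab≢0 co eq = a , b , refl , co , linear₁ 1ℤ eq (solve (x ∷ a ∷ b ∷ K ∷ κ ∷ []))
  excludes₁ η x a b (inj₂ refl) ab≢0 co eq = contradiction
    (negative₁ x a b co (trans eq (solve (a ∷ b ∷ κ ∷ [])))) ab≢0

  excludes-both : (∀ η x a b → IsUnit η → Coprime (κ * a) (+ 5 * b) →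
    x ^ 2 + K * (a * b) ^ 2 ≡ η * (κ ^ 2 * a ^ 4 + + 125 * b ^ 4) → a * b ≡ 0ℤ) → Excludes κ K
  excludes-both none₂ x z z≢0 (quartic₁ η a b un refl co eq) = excludes₁ η x a b un z≢0 co eq
  excludes-both none₂ x z z≢0 (quartic₂ η a b un refl co eq) = contradiction (none₂ η x a b un co eq) z≢0

-- For κ = 1 the two constructors of `Quartic` describe the same shape, so only the sign -1 has to
-- be ruled out.
excludes-κ≡1 : ∀ K → (∀ x a b → Coprime a (+ 5 * 1ℤ * b) →
  x ^ 2 + K * (a * b) ^ 2 ≡ -1ℤ * (1ℤ * a ^ 4 + + 125 * 1ℤ ^ 2 * b ^ 4) → a * b ≡ 0ℤ) → Excludes 1ℤ K
excludes-κ≡1 K neg x z z≢0 (quartic₁ η a b un refl co eq) = excludes₁ 1ℤ K neg η x a b un z≢0 co eq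
excludes-κ≡1 K neg x z z≢0 (quartic₂ η a b un refl co eq) = excludes₁ 1ℤ K neg η x a b un z≢0
  (subst (λ t → Coprime t (+ 5 * b)) (ℤ.*-identityˡ a) co) (trans eq (solve (η ∷ a ∷ b ∷ [])))

exclude-1-25 : Excludes 1ℤ (+ 25 * (1ℤ * 1ℤ))
exclude-1-25 = excludes-κ≡1 (+ 25) (λ x a b co eq → definite 25 0 125 x a b (λ ()) eq)

-- The obstruction is 2-adic. Odd a and b would give x² ≡ 20 mod 32, hence a square congruent to 5
-- mod 8; if exactly one of them is odd, x² ≡ 3 mod 4. So both are even, against coprimality.
exclude-1-50 : Excludes 1ℤ (-[1+ 49 ] * (1ℤ * 1ℤ))
exclude-1-50 = excludes-κ≡1 -[1+ 49 ] (λ x a b co eq → ⊥-elim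
  (common-divisor 2 tt (coprime-∣ʳ {c = b} (divides (+ 5) refl) co)
    (a-even x a b eq) (b-even x a b eq (a-even x a b eq))))
  where
  a-even : ∀ x a b → x ^ 2 + -[1+ 49 ] * (a * b) ^ 2 ≡ -1ℤ * (1ℤ * a ^ 4 + + 125 * b ^ 4) → + 2 ∣ a
  a-even x a b eq = cancel-∣ (+ 16) (λ ())
    (torsor-mod 32 -[1+ 49 ] -1ℤ 1ℤ (+ 125) (Κ (+ 16) ⊗ Ι 1F) tt x a b eq)
  b-even : ∀ x a b → x ^ 2 + -[1+ 49 ] * (a * b) ^ 2 ≡ -1ℤ * (1ℤ * a ^ 4 + + 125 * b ^ 4) →
    + 2 ∣ a → + 2 ∣ b
  b-even x a b eq 2∣a = cancel-∣ (+ 2) (λ ())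
    (Modular.modular 4 (torsor 4 -[1+ 49 ] -1ℤ 1ℤ (+ 125) ∷ Κ (+ 2) ⊗ Ι 1F ∷ []) (Κ (+ 2) ⊗ Ι 2F) tt
      (x Vec.∷ a Vec.∷ b Vec.∷ Vec.[]) (≡⇒∣ eq All.∷ ∣-* (∣-refl {+ 2}) 2∣a All.∷ All.[]))

-- Two of the three spaces die modulo 3, where -1 is not a square. The third, x² - 75a²b² = -(9a⁴ +
-- 125b⁴), dies 2-adically: x² ≡ 5 mod 8 if a and b are odd, x² ≡ 3 mod 4 if only one is.
exclude-3-75 : Excludes (+ 3) (+ 25 * (-1ℤ * + 3))
exclude-3-75 = excludes-both (+ 3) -[1+ 74 ]
  (λ x a b co eq → ⊥-elim (common-divisor 3 tt co
    (torsor-mod 3 -[1+ 74 ] -1ℤ 1ℤ (+ 1125) (Ι 1F) tt x a b eq) (divides (+ 5 * b) (solve (b ∷ [])))))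
  none₂
  where
  none₂ : ∀ η x a b → IsUnit η → Coprime (+ 3 * a) (+ 5 * b) →
    x ^ 2 + -[1+ 74 ] * (a * b) ^ 2 ≡ η * (+ 9 * a ^ 4 + + 125 * b ^ 4) → a * b ≡ 0ℤ
  none₂ η x a b (inj₁ refl) co eq = ⊥-elim (common-divisor 3 tt co (divides a (ℤ.*-comm (+ 3) a))
    (∣-*ˡ (+ 5) (torsor-mod 3 -[1+ 74 ] 1ℤ (+ 9) (+ 125) (Ι 2F) tt x a b eq)))
  none₂ η x a b (inj₂ refl) co eq = ⊥-elim (common-divisor 2 tt co
    (∣-*ˡ (+ 3) (cancel-∣ (+ 4) (λ ()) (torsor-mod 8 -[1+ 74 ] -1ℤ (+ 9) (+ 125) (Κ (+ 4) ⊗ Ι 1F) tt x a b eq)))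
    (∣-*ˡ (+ 5) (cancel-∣ (+ 4) (λ ()) (torsor-mod 8 -[1+ 74 ] -1ℤ (+ 9) (+ 125) (Κ (+ 4) ⊗ Ι 2F) tt x a b eq))))

-- Here the sign -1 is impossible over the reals in both shapes, and the remaining space has x² ≡
-- 2b⁴ mod 3, which makes 3 a common divisor.
exclude-3-150 : Excludes (+ 3) (-[1+ 49 ] * (-1ℤ * + 3))
exclude-3-150 = excludes-both (+ 3) (+ 150) (λ x a b co eq → definite 150 0 1125 x a b (λ ()) eq) none₂
  where
  none₂ : ∀ η x a b → IsUnit η → Coprime (+ 3 * a) (+ 5 * b) →
    x ^ 2 + + 150 * (a * b) ^ 2 ≡ η * (+ 9 * a ^ 4 + + 125 * b ^ 4) → a * b ≡ 0ℤ
  none₂ η x a b (inj₁ refl) co eq = ⊥-elim (common-divisor 3 tt co (divides a (ℤ.*-comm (+ 3) a))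
    (∣-*ˡ (+ 5) (torsor-mod 3 (+ 150) 1ℤ (+ 9) (+ 125) (Ι 2F) tt x a b eq)))
  none₂ η x a b (inj₂ refl) co eq = definite 150 8 125 x a b (λ ()) eq

module _ (k κ² : ℤ) where

  isogenous : Expr ℤ 3
  isogenous = (Κ (+ 2) ⊗ Ι 0F) ⊛ 2 ⊕ ⊝
    (Ι 1F ⊛ 4 ⊕ ⊝ (Κ k ⊗ (Ι 1F ⊛ 2 ⊗ Ι 2F ⊛ 2)) ⊕ Κ (+ 125) ⊗ (Κ κ² ⊗ Ι 2F ⊛ 4))

  -- In both applications, f odd forces c odd; then c⁴ ≡ f⁴ ≡ 1 mod 16 and c²f² ≡ 1 mod 8 make the
  -- right side divisible by 16, so 4 ∣ a². The enumeration tests 2 ∣ fa, scaled by 8, and the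
  -- oddness of f is used afterwards.
  even-root : T (Modular.allResidues 16 3 (Modular.follows 16 (isogenous ∷ []) (Κ (+ 8) ⊗ (Ι 2F ⊗ Ι 0F)))) →
    ∀ a c f → Coprime f (+ 2) →
    (+ 2 * a) ^ 2 ≡ c ^ 4 - k * (c ^ 2 * f ^ 2) + + 125 * (κ² * f ^ 4) → + 2 ∣ a
  even-root ok a c f co eq = coprime-divisor {b = f} (coprime-sym co) (cancel-∣ (+ 8) (λ ())
    (Modular.modular 16 (isogenous ∷ []) (Κ (+ 8) ⊗ (Ι 2F ⊗ Ι 0F)) ok (a Vec.∷ c Vec.∷ f Vec.∷ Vec.[])
      (≡⇒∣ eq All.∷ All.[])))

quartic-1 : ∀ x y z → Coprime x (+ 5 * z) →
  y ^ 2 ≡ x ^ 4 + + 50 * (x ^ 2 * z ^ 2) + + 125 * z ^ 4 → z ≡ 0ℤ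
quartic-1 x y z co eq = Descent.no-solution 1ℤ 1ℤ refl (λ ()) (λ _ → inj₂ coprime-1)
  (coprime 1ℤ 0ℤ refl) exclude-1-25 exclude-1-50 (even-root -[1+ 49 ] 1ℤ tt) z
  (x , y , co , trans eq (solve (x ∷ z ∷ [])))

-- The twist of `quartic-1` by -3, that is ε = -1 and κ = 3: -150 = 50 · (-3) and 1125 = 125 · 9.
quartic-3 : ∀ x y z → Coprime x (+ 15 * z) →
  y ^ 2 ≡ x ^ 4 - + 150 * (x ^ 2 * z ^ 2) + + 1125 * z ^ 4 → z ≡ 0ℤ
quartic-3 x y z co eq = Descent.no-solution -1ℤ (+ 3) refl (λ ()) 3-prime-like
  (coprime 1ℤ -1ℤ refl) exclude-3-75 exclude-3-150 (even-root (+ 150) (+ 9) tt) z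
  (x , y , co , trans eq (solve (x ∷ z ∷ [])))

-- Eisenstein integers

infix 5 _+_ω

record 𝔼 : Set where
  constructor _+_ω
  field
    re im : ℤ

module Eisenstein where

  add mul : 𝔼 → 𝔼 → 𝔼
  add (a + b ω) (c + d ω) = (a + c) + (b + d) ω
  mul (a + b ω) (c + d ω) = (a * c - b * d) + (a * d + b * c - b * d) ω

  neg : 𝔼 → 𝔼
  neg (a + b ω) = (- a) + (- b) ω

  isCommutativeRing : IsCommutativeRing _≡_ add mul neg (0ℤ + 0ℤ ω) (1ℤ + 0ℤ ω)
  isCommutativeRing = record
    { isRing = record
      { +-isAbelianGroup = record
        { isGroup = record
          { isMonoid = record
            { isSemigroup = record
              { isMagma = record { isEquivalence = isEquivalence ; ∙-cong = cong₂ add }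
              ; assoc = λ { (a + b ω) (c + d ω) (e + f ω) → cong₂ _+_ω (ℤ.+-assoc a c e) (ℤ.+-assoc b d f) }
              }
            ; identity = (λ { (a + b ω) → cong₂ _+_ω (ℤ.+-identityˡ a) (ℤ.+-identityˡ b) })
                       , (λ { (a + b ω) → cong₂ _+_ω (ℤ.+-identityʳ a) (ℤ.+-identityʳ b) })
            }
          ; inverse = (λ { (a + b ω) → cong₂ _+_ω (ℤ.+-inverseˡ a) (ℤ.+-inverseˡ b) })
                    , (λ { (a + b ω) → cong₂ _+_ω (ℤ.+-inverseʳ a) (ℤ.+-inverseʳ b) })
          ; ⁻¹-cong = cong neg
          }
        ; comm = λ { (a + b ω) (c + d ω) → cong₂ _+_ω (ℤ.+-comm a c) (ℤ.+-comm b d) }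
        }
      ; *-cong = cong₂ mul
      ; *-assoc = λ { (a + b ω) (c + d ω) (e + f ω) → cong₂ _+_ω
          (assoc-re a b c d e f) (assoc-im a b c d e f) }
      ; *-identity = (λ { (a + b ω) → cong₂ _+_ω (solve (a ∷ b ∷ [])) (solve (a ∷ b ∷ [])) })
                   , (λ { (a + b ω) → cong₂ _+_ω (solve (a ∷ b ∷ [])) (solve (a ∷ b ∷ [])) })
      ; distrib = (λ { (a + b ω) (c + d ω) (e + f ω) → cong₂ _+_ω
                    (distribˡ-re a b c d e f) (distribˡ-im a b c d e f) })
                , (λ { (a + b ω) (c + d ω) (e + f ω) → cong₂ _+_ω
                    (distribʳ-re a b c d e f) (distribʳ-im a b c d e f) })
      }
    ; *-comm = λ { (a + b ω) (c + d ω) → cong₂ _+_ω (solve (a ∷ b ∷ c ∷ d ∷ [])) (solve (a ∷ b ∷ c ∷ d ∷ [])) }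
    }
    where
    assoc-re : ∀ a b c d e f → (a * c - b * d) * e - (a * d + b * c - b * d) * f ≡
      a * (c * e - d * f) - b * (c * f + d * e - d * f)
    assoc-re = solve-∀
    assoc-im : ∀ a b c d e f →
      (a * c - b * d) * f + (a * d + b * c - b * d) * e - (a * d + b * c - b * d) * f ≡
      a * (c * f + d * e - d * f) + b * (c * e - d * f) - b * (c * f + d * e - d * f)
    assoc-im = solve-∀
    distribˡ-re : ∀ a b c d e f → a * (c + e) - b * (d + f) ≡ (a * c - b * d) + (a * e - b * f)
    distribˡ-re = solve-∀
    distribˡ-im : ∀ a b c d e f → a * (d + f) + b * (c + e) - b * (d + f) ≡
      (a * d + b * c - b * d) + (a * f + b * e - b * f)
    distribˡ-im = solve-∀
    distribʳ-re : ∀ a b c d e f → (c + e) * a - (d + f) * b ≡ (c * a - d * b) + (e * a - f * b)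
    distribʳ-re = solve-∀
    distribʳ-im : ∀ a b c d e f → (c + e) * b + (d + f) * a - (d + f) * b ≡
      (c * b + d * a - d * b) + (e * b + f * a - f * b)
    distribʳ-im = solve-∀

  norm : 𝔼 → ℤ
  norm (a + b ω) = a ^ 2 - a * b + b ^ 2

  norm-mul : ∀ α β → norm (mul α β) ≡ norm α * norm β
  norm-mul (a + b ω) (c + d ω) = lemma a b c d
    where
    lemma : ∀ a b c d → (a * c - b * d) ^ 2 - (a * c - b * d) * (a * d + b * c - b * d) +
      (a * d + b * c - b * d) ^ 2 ≡ (a ^ 2 - a * b + b ^ 2) * (c ^ 2 - c * d + d ^ 2)
    lemma = solve-∀

  -- The completed square gives both the definiteness of the norm and the bound on the coordinates
  -- of units.
  4norm : ∀ a b → + 4 * norm (a + b ω) ≡ + 3 * b ^ 2 + (+ 2 * a - b) ^ 2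
  4norm = lemma
    where
    lemma : ∀ a b → + 4 * (a ^ 2 - a * b + b ^ 2) ≡ + 3 * b ^ 2 + (+ 2 * a - b) ^ 2
    lemma = solve-∀

  norm-swap : ∀ a b → norm (a + b ω) ≡ norm (b + a ω)
  norm-swap = lemma
    where
    lemma : ∀ a b → a ^ 2 - a * b + b ^ 2 ≡ b ^ 2 - b * a + a ^ 2
    lemma = solve-∀

  norm≡0⇒im≡0 : ∀ a b → norm (a + b ω) ≡ 0ℤ → b ≡ 0ℤ
  norm≡0⇒im≡0 a b eq = square-≡0 b (cancel (+ 3) (λ ()) (nonneg-sum (nonneg-* 3 (square-nonneg b))
    (square-nonneg (+ 2 * a - b)) (trans (sym (4norm a b)) (cong (+ 4 *_) eq))))

  norm≡0 : ∀ α → norm α ≡ 0ℤ → α ≡ 0ℤ + 0ℤ ω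
  norm≡0 (a + b ω) eq = cong₂ _+_ω (norm≡0⇒im≡0 b a (trans (norm-swap b a) eq)) (norm≡0⇒im≡0 a b eq)

  round : ∀ x n → n ≢ 0ℤ → ∃₂ λ q r → x ≡ q * n + r × 2 ℕ.* abs r ℕ.≤ abs n
  round x +0       n≢0 = contradiction refl n≢0
  round x -[1+ k ] n≢0 with q , r , eq , r≤ ← round x +[1+ k ] (λ ()) =
    - q , r , trans eq (lemma q r +[1+ k ]) , r≤
    where
    lemma : ∀ q r n → q * n + r ≡ - q * - n + r
    lemma = solve-∀
  round x n@(+[1+ k ]) n≢0 with 2 ℕ.* (x ℤ.%ℕ suc k) ℕ.≤? suc k
  ... | yes small = x ℤ./ℕ suc k , + (x ℤ.%ℕ suc k) ,
    trans (ℤ.a≡a%ℕn+[a/ℕn]*n x (suc k)) (ℤ.+-comm (+ (x ℤ.%ℕ suc k)) (x ℤ./ℕ suc k * n)) , small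
  -- The remainder exceeds n/2, so the quotient is rounded up and the new remainder is r - n = -l.
  ... | no  large = x ℤ./ℕ suc k + 1ℤ , - + l , linear₂ 1ℤ -1ℤ
      (ℤ.a≡a%ℕn+[a/ℕn]*n x (suc k)) (sym (cong +_ (ℕ.m+[n∸m]≡n r≤n)))
      (lemma x (x ℤ./ℕ suc k) n (+ (x ℤ.%ℕ suc k)) (+ l)) ,
      subst (λ t → 2 ℕ.* t ℕ.≤ suc k) (sym (ℤ.∣-i∣≡∣i∣ (+ l))) 2l≤n
    where
    r l : ℕ
    r = x ℤ.%ℕ suc k
    l = suc k ℕ.∸ r
    r≤n : r ℕ.≤ suc k
    r≤n = ℕ.<⇒≤ (ℤ.n%ℕd<d x (suc k))
    2l≤n : 2 ℕ.* l ℕ.≤ suc k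
    2l≤n = ℕ.+-cancelʳ-≤ (2 ℕ.* r) (2 ℕ.* l) (suc k) (begin
      2 ℕ.* l ℕ.+ 2 ℕ.* r      ≡⟨ ℕ.*-distribˡ-+ 2 l r ⟨
      2 ℕ.* (l ℕ.+ r)          ≡⟨ cong (2 ℕ.*_) (ℕ.m∸n+n≡m r≤n) ⟩
      2 ℕ.* suc k              ≡⟨ cong (suc k ℕ.+_) (ℕ.+-identityʳ (suc k)) ⟩
      suc k ℕ.+ suc k          ≤⟨ ℕ.+-monoʳ-≤ (suc k) (ℕ.<⇒≤ (ℕ.≰⇒> large)) ⟩
      suc k ℕ.+ 2 ℕ.* r        ∎)
      where open ℕ.≤-Reasoning
    lemma : ∀ x q n r l → x - ((q + 1ℤ) * n + - l) ≡ 1ℤ * (x - (r + q * n)) + -1ℤ * (n - (r + l))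
    lemma = solve-∀

  -- With both coordinates at most n/2 the norm is at most 3n²/4, the margin that makes ℤ[ω]
  -- norm-Euclidean.
  small-norm : ∀ r s n → 0 ℕ.< n → 2 ℕ.* abs r ℕ.≤ n → 2 ℕ.* abs s ℕ.≤ n → abs (norm (r + s ω)) ℕ.< n ℕ.* n
  small-norm r s n 0<n 2r≤n 2s≤n = ℕ.*-cancelˡ-< 4 _ _ (begin-strict
    4 ℕ.* abs (r ^ 2 - r * s + s ^ 2)
      ≤⟨ ℕ.*-monoʳ-≤ 4 (ℕ.≤-trans (ℤ.∣i+j∣≤∣i∣+∣j∣ (r ^ 2 - r * s) (s ^ 2))
           (ℕ.+-monoˡ-≤ (abs (s ^ 2)) (ℤ.∣i-j∣≤∣i∣+∣j∣ (r ^ 2) (r * s)))) ⟩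
    4 ℕ.* (abs (r * r) ℕ.+ abs (r * s) ℕ.+ abs (s * s))
      ≡⟨ cong (4 ℕ.*_) (cong₂ ℕ._+_ (cong₂ ℕ._+_ (ℤ.abs-* r r) (ℤ.abs-* r s)) (ℤ.abs-* s s)) ⟩
    4 ℕ.* (abs r ℕ.* abs r ℕ.+ abs r ℕ.* abs s ℕ.+ abs s ℕ.* abs s)
      ≡⟨ lemma (abs r) (abs s) ⟩
    2 ℕ.* abs r ℕ.* (2 ℕ.* abs r) ℕ.+ 2 ℕ.* abs r ℕ.* (2 ℕ.* abs s) ℕ.+ 2 ℕ.* abs s ℕ.* (2 ℕ.* abs s)
      ≤⟨ ℕ.+-mono-≤ (ℕ.+-mono-≤ (ℕ.*-mono-≤ 2r≤n 2r≤n) (ℕ.*-mono-≤ 2r≤n 2s≤n)) (ℕ.*-mono-≤ 2s≤n 2s≤n) ⟩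
    n ℕ.* n ℕ.+ n ℕ.* n ℕ.+ n ℕ.* n
      <⟨ ℕ.m<m+n (n ℕ.* n ℕ.+ n ℕ.* n ℕ.+ n ℕ.* n) (ℕ.*-mono-< 0<n 0<n) ⟩
    n ℕ.* n ℕ.+ n ℕ.* n ℕ.+ n ℕ.* n ℕ.+ n ℕ.* n
      ≡⟨ lemma′ (n ℕ.* n) ⟩
    4 ℕ.* (n ℕ.* n) ∎)
    where
    open ℕ.≤-Reasoning
    lemma : ∀ r s → 4 ℕ.* (r ℕ.* r ℕ.+ r ℕ.* s ℕ.+ s ℕ.* s) ≡
      2 ℕ.* r ℕ.* (2 ℕ.* r) ℕ.+ 2 ℕ.* r ℕ.* (2 ℕ.* s) ℕ.+ 2 ℕ.* s ℕ.* (2 ℕ.* s)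
    lemma = ℕ-solve-∀
    lemma′ : ∀ m → m ℕ.+ m ℕ.+ m ℕ.+ m ≡ 4 ℕ.* m
    lemma′ = ℕ-solve-∀

  -- `A` and `B` are the coordinates of α times the conjugate of β; rounding A/n and B/n gives the
  -- quotient. The remainder ρ times the conjugate of β is then r + sω, so N(ρ) n = N(r + sω) < n².
  divide : ∀ α β → β ≢ 0ℤ + 0ℤ ω →
    ∃₂ λ γ ρ → α ≡ add (mul γ β) ρ × abs (norm ρ) ℕ.< abs (norm β)
  divide (a + b ω) (c + d ω) β≢0 = combine (round A n n≢0) (round B n n≢0)
    where
    n A B : ℤ
    n = norm (c + d ω)
    A = a * (c - d) + b * d
    B = b * c - a * d
    n≢0 : n ≢ 0ℤ
    n≢0 n≡0 = β≢0 (norm≡0 (c + d ω) n≡0)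
    combine : (∃₂ λ q r → A ≡ q * n + r × 2 ℕ.* abs r ℕ.≤ abs n) →
      (∃₂ λ q r → B ≡ q * n + r × 2 ℕ.* abs r ℕ.≤ abs n) →
      ∃₂ λ γ ρ → (a + b ω) ≡ add (mul γ (c + d ω)) ρ × abs (norm ρ) ℕ.< abs (norm (c + d ω))
    combine (q , r , Aeq , r≤) (p , s , Beq , s≤) = (q + p ω) , (ρ₁ + ρ₂ ω) ,
      cong₂ _+_ω (lemma₁ a c d q p) (lemma₂ b c d q p) ,
      ℕ.*-cancelʳ-< (abs n) (abs (norm (ρ₁ + ρ₂ ω))) (abs n)
        (subst (ℕ._< abs n ℕ.* abs n) (trans (cong abs norms) (ℤ.abs-* (norm (ρ₁ + ρ₂ ω)) n))
          (small-norm r s (abs n) (ℕ.n≢0⇒n>0 (λ |n|≡0 → n≢0 (ℤ.∣i∣≡0⇒i≡0 |n|≡0))) r≤ s≤))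
      where
      ρ₁ ρ₂ : ℤ
      ρ₁ = a - (q * c - p * d)
      ρ₂ = b - (q * d + p * c - p * d)
      lemma₁ : ∀ a c d q p → a ≡ (q * c - p * d) + (a - (q * c - p * d))
      lemma₁ = solve-∀
      lemma₂ : ∀ b c d q p → b ≡ (q * d + p * c - p * d) + (b - (q * d + p * c - p * d))
      lemma₂ = solve-∀
      remainder : ∀ x q n r → x ≡ q * n + r → x - q * n ≡ r
      remainder x q n r eq = linear₁ 1ℤ eq (solve (x ∷ q ∷ n ∷ r ∷ []))
      lemma₃ : ∀ a b c d q p →
        let n = c ^ 2 - c * d + d ^ 2
            r = a * (c - d) + b * d - q * n
            s = b * c - a * d - p * n
            ρ₁ = a - (q * c - p * d)
            ρ₂ = b - (q * d + p * c - p * d)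
        in r ^ 2 - r * s + s ^ 2 ≡ (ρ₁ ^ 2 - ρ₁ * ρ₂ + ρ₂ ^ 2) * n
      lemma₃ = solve-∀
      norms : norm (r + s ω) ≡ norm (ρ₁ + ρ₂ ω) * n
      norms = trans (cong₂ (λ r s → norm (r + s ω)) (sym (remainder A q n r Aeq)) (sym (remainder B p n s Beq)))
        (lemma₃ a b c d q p)

  _≟0 : ∀ α → Dec (α ≡ 0ℤ + 0ℤ ω)
  (a + b ω) ≟0 with a ℤ.≟ 0ℤ | b ℤ.≟ 0ℤ
  ... | yes refl | yes refl = yes refl
  ... | no  a≢0  | _        = no (λ { refl → a≢0 refl })
  ... | yes _    | no b≢0   = no (λ { refl → b≢0 refl })

open Eisenstein using (norm; norm-mul; 4norm; norm-swap; norm≡0)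
module 𝔼-Div = Divisibility Eisenstein.isCommutativeRing

𝔼-ring : AlmostCommutativeRing _ _
𝔼-ring = fromCommutativeRing (record { isCommutativeRing = Eisenstein.isCommutativeRing }) (λ _ → nothing)

open AlmostCommutativeRing 𝔼-ring using () renaming (_*_ to _*𝔼_; _^_ to _^𝔼_)

abstract
  bezout𝔼 : ∀ α β → 𝔼-Div.GCD α β
  bezout𝔼 = 𝔼-Div.Euclidean.bezout (λ α → abs (norm α)) Eisenstein._≟0 Eisenstein.divide

abs≤1 : ∀ b c → + 4 ≡ + 3 * b ^ 2 + c ^ 2 → abs b ℕ.≤ 1
abs≤1 b c eq = ℕ.≮⇒≥ λ 1<|b| → ℕ.<⇒≱ (ℕ.s≤s (ℕ.s≤s (ℕ.s≤s (ℕ.s≤s (ℕ.s≤s ℕ.z≤n))))) (begin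
  12                                               ≤⟨ ℕ.*-monoʳ-≤ 3 (ℕ.*-mono-≤ 1<|b| 1<|b|) ⟩
  3 ℕ.* (abs b ℕ.* abs b)                          ≤⟨ ℕ.m≤m+n _ (abs c ℕ.* abs c) ⟩
  3 ℕ.* (abs b ℕ.* abs b) ℕ.+ abs c ℕ.* abs c      ≡⟨ ℤ.+-injective 4≡ ⟨
  4                                                ∎)
  where
  open ℕ.≤-Reasoning
  square-abs : ∀ x → x ^ 2 ≡ + (abs x ℕ.* abs x)
  square-abs (+ n)    = sym (ℤ.pos-* n n)
  square-abs -[1+ n ] = refl
  4≡ : + 4 ≡ + (3 ℕ.* (abs b ℕ.* abs b) ℕ.+ abs c ℕ.* abs c)
  4≡ = trans eq (cong₂ _+_ (trans (cong (+ 3 *_) (square-abs b)) (sym (ℤ.pos-* 3 (abs b ℕ.* abs b)))) (square-abs c))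

data Small : ℤ → Set where
  minus : Small -1ℤ
  nil   : Small 0ℤ
  plus  : Small 1ℤ

small : ∀ b → abs b ℕ.≤ 1 → Small b
small (+ 0)           _ = nil
small (+ 1)           _ = plus
small -[1+ 0 ]        _ = minus
small (+ suc (suc n)) (ℕ.s≤s ())
small -[1+ suc n ]    (ℕ.s≤s ())

-- The units form a cyclic group of order 6, so α⁶ = 1 and α = (α⁻¹)⁵; the listed witnesses are the
-- inverses.
unit-fifth-power : ∀ α → norm α ≡ 1ℤ → ∃ λ β → α ≡ β ^𝔼 5
unit-fifth-power (a + b ω) eq = fifth a b
    (small a (abs≤1 a (+ 2 * b - a) (trans (cong (+ 4 *_) (sym (trans (norm-swap b a) eq))) (4norm b a))))
    (small b (abs≤1 b (+ 2 * a - b) (trans (cong (+ 4 *_) (sym eq)) (4norm a b)))) eq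
  where
  fifth : ∀ a b → Small a → Small b → norm (a + b ω) ≡ 1ℤ → ∃ λ β → (a + b ω) ≡ β ^𝔼 5
  fifth _ _ minus minus _ = (0ℤ + 1ℤ ω)   , refl
  fifth _ _ minus nil   _ = (-1ℤ + 0ℤ ω)  , refl
  fifth _ _ minus plus  ()
  fifth _ _ nil   minus _ = (1ℤ + 1ℤ ω)   , refl
  fifth _ _ nil   nil   ()
  fifth _ _ nil   plus  _ = (-1ℤ + -1ℤ ω) , refl
  fifth _ _ plus  minus ()
  fifth _ _ plus  nil   _ = (1ℤ + 0ℤ ω)   , refl
  fifth _ _ plus  plus  _ = (0ℤ + -1ℤ ω)  , refl

norm-of-unit : ∀ x y → x * y ≡ 1ℤ → ∀ {b c} → + 4 * x ≡ + 3 * b ^ 2 + c ^ 2 → x ≡ 1ℤ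
norm-of-unit x y xy≡1 {b} {c} 4x≡ = [ id , negative ]′
  (abs-≡⇒≡± x 1ℤ (ℕ.m*n≡1⇒m≡1 (abs x) (abs y) (trans (sym (ℤ.abs-* x y)) (cong abs xy≡1))))
  where
  negative : x ≡ -1ℤ → x ≡ 1ℤ
  negative refl = contradiction (subst (0ℤ ℤ.≤_) (sym 4x≡)
    (nonneg-+ (nonneg-* 3 (square-nonneg b)) (square-nonneg c))) λ ()

-- Taking norms in both divisibilities shows that the cofactor `w` has a norm dividing 1, so it is a
-- unit and hence a fifth power itself.
associate-fifth-power : ∀ α γ → norm α ≢ 0ℤ → γ ^𝔼 5 𝔼-Div.∣ α → α 𝔼-Div.∣ γ ^𝔼 5 → ∃ λ δ → α ≡ δ ^𝔼 5
associate-fifth-power α γ Nα≢0 (𝔼-Div.divides w@(a + b ω) αeq) (𝔼-Div.divides w′ γeq) =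
  multiply (unit-fifth-power w (norm-of-unit (norm w) (norm w′)
    (cancel (norm α) Nα≢0 norms) {b} {+ 2 * a - b} (4norm a b)))
  where
  norms : norm α * (norm w * norm w′) ≡ norm α * 1ℤ
  norms = linear₂ -1ℤ (- norm w) (trans (cong norm αeq) (norm-mul w (γ ^𝔼 5)))
    (trans (cong norm γeq) (norm-mul w′ α)) (lemma (norm α) (norm w) (norm w′) (norm (γ ^𝔼 5)))
    where
    lemma : ∀ n w w′ g → n * (w * w′) - n * 1ℤ ≡ -1ℤ * (n - w * g) + - w * (g - w′ * n)
    lemma = solve-∀
  multiply : (∃ λ β → w ≡ β ^𝔼 5) → ∃ λ δ → α ≡ δ ^𝔼 5
  multiply (β , weq) = β *𝔼 γ , trans αeq (trans (cong (_*𝔼 (γ ^𝔼 5)) weq) (sym (𝔼-Div.*-^-distrib β γ 4)))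

-- Fifth powers in the Eisenstein integers

fifth-re fifth-im : ℤ → ℤ → ℤ
fifth-re p q = p ^ 5 - + 10 * (p ^ 3 * q ^ 2) + + 10 * (p ^ 2 * q ^ 3) - q ^ 5
fifth-im p q = q * (+ 5 * p ^ 4 - + 10 * (p ^ 3 * q) + + 5 * (p * q ^ 3) - q ^ 4)

fifth-expand : ∀ p q → (p + q ω) ^𝔼 5 ≡ (fifth-re p q + fifth-im p q ω)
fifth-expand p q = cong₂ _+_ω (re-part p q) (im-part p q)
  where
  re-part : ∀ p q →
    let p₂ = p * p - q * q ; q₂ = p * q + q * p - q * q
        p₃ = p₂ * p - q₂ * q ; q₃ = p₂ * q + q₂ * p - q₂ * q
        p₄ = p₃ * p - q₃ * q ; q₄ = p₃ * q + q₃ * p - q₃ * q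
    in p₄ * p - q₄ * q ≡ p ^ 5 - + 10 * (p ^ 3 * q ^ 2) + + 10 * (p ^ 2 * q ^ 3) - q ^ 5
  re-part = solve-∀
  im-part : ∀ p q →
    let p₂ = p * p - q * q ; q₂ = p * q + q * p - q * q
        p₃ = p₂ * p - q₂ * q ; q₃ = p₂ * q + q₂ * p - q₂ * q
        p₄ = p₃ * p - q₃ * q ; q₄ = p₃ * q + q₃ * p - q₃ * q
    in p₄ * q + q₄ * p - q₄ * q ≡ q * (+ 5 * p ^ 4 - + 10 * (p ^ 3 * q) + + 5 * (p * q ^ 3) - q ^ 4)
  im-part = solve-∀

embed-mul : ∀ a b → (a + 0ℤ ω) *𝔼 (b + 0ℤ ω) ≡ (a * b + 0ℤ ω)
embed-mul a b = cong₂ _+_ω (solve (a ∷ b ∷ [])) (solve (a ∷ b ∷ []))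

embed-fifth : ∀ e → (e + 0ℤ ω) ^𝔼 5 ≡ (e ^ 5 + 0ℤ ω)
embed-fifth e = step (e ^ 4) (step (e ^ 3) (step (e ^ 2) (embed-mul e e)))
  where
  step : ∀ x {ξ} → ξ ≡ (x + 0ℤ ω) → ξ *𝔼 (e + 0ℤ ω) ≡ (x * e + 0ℤ ω)
  step x eq = trans (cong (_*𝔼 (e + 0ℤ ω)) eq) (embed-mul x e)

-- The second element is the conjugate of α = U - Vω, and the two differ by V√-3, where √-3 = 1 +
-- 2ω. Now α is prime to V because U is, and prime to √-3 because its norm is prime to 3.
coprime-conjugate : ∀ U V → Coprime U V → Coprime (U ^ 2 + U * V + V ^ 2) (+ 3) →
  𝔼-Div.Coprime (U + - V ω) ((U + V) + V ω)
coprime-conjugate U V (coprime u v identity) (coprime s t identity′) =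
  𝔼-Div.coprime-sym (subst (λ ξ → 𝔼-Div.Coprime ξ (U + - V ω)) difference
    (𝔼-Div.coprime-+ (1ℤ + 0ℤ ω) (𝔼-Div.coprime-sym (𝔼-Div.coprime-* α⊥V α⊥√-3))))
  where
  α⊥V : 𝔼-Div.Coprime (U + - V ω) (V + 0ℤ ω)
  α⊥V = 𝔼-Div.coprime (u + 0ℤ ω) (v + u ω) (cong₂ _+_ω
    (linear₁ 1ℤ identity (lemma₁ u v U V)) (lemma₂ u v U V))
    where
    lemma₁ : ∀ u v U V → (u * U - 0ℤ * - V) + (v * V - u * 0ℤ) - 1ℤ ≡ 1ℤ * (u * U + v * V - 1ℤ)
    lemma₁ = solve-∀
    lemma₂ : ∀ u v U V → (u * - V + 0ℤ * U - 0ℤ * - V) + (v * 0ℤ + u * V - u * 0ℤ) ≡ 0ℤ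
    lemma₂ = solve-∀
  α⊥3 : 𝔼-Div.Coprime (U + - V ω) (+ 3 + 0ℤ ω)
  α⊥3 = 𝔼-Div.coprime (s * (U + V) + s * V ω) (t + 0ℤ ω) (cong₂ _+_ω
    (linear₁ 1ℤ identity′ (lemma₁ s t U V)) (lemma₂ s t U V))
    where
    lemma₁ : ∀ s t U V → (s * (U + V) * U - s * V * - V) + (t * + 3 - 0ℤ * 0ℤ) - 1ℤ ≡
      1ℤ * (s * (U ^ 2 + U * V + V ^ 2) + t * + 3 - 1ℤ)
    lemma₁ = solve-∀
    lemma₂ : ∀ s t U V → (s * (U + V) * - V + s * V * U - s * V * - V) + (t * 0ℤ + 0ℤ * + 3 - 0ℤ * 0ℤ) ≡ 0ℤ
    lemma₂ = solve-∀
  α⊥√-3 : 𝔼-Div.Coprime (U + - V ω) (1ℤ + + 2 ω)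
  α⊥√-3 = 𝔼-Div.coprime-∣ʳ (𝔼-Div.divides (-1ℤ + -[1+ 1 ] ω) refl) α⊥3
  difference : Eisenstein.add ((V + 0ℤ ω) *𝔼 (1ℤ + + 2 ω)) ((1ℤ + 0ℤ ω) *𝔼 (U + - V ω)) ≡ ((U + V) + V ω)
  difference = cong₂ _+_ω (lemma₁ U V) (lemma₂ U V)
    where
    lemma₁ : ∀ U V → (V * 1ℤ - 0ℤ * + 2) + (1ℤ * U - 0ℤ * - V) ≡ U + V
    lemma₁ = solve-∀
    lemma₂ : ∀ U V → (V * + 2 + 0ℤ * 1ℤ - 0ℤ * + 2) + (1ℤ * - V + 0ℤ * U - 0ℤ * - V) ≡ V
    lemma₂ = solve-∀

-- The norm form is that of α = U - Vω, so α times its conjugate is e⁵. The two are coprime and all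
-- units are fifth powers, hence α = (p + qω)⁵.
norm-fifth-power : ∀ U V e → Coprime U V → Coprime (U ^ 2 + U * V + V ^ 2) (+ 3) →
  U ^ 2 + U * V + V ^ 2 ≡ e ^ 5 → ∃₂ λ p q → U ≡ fifth-re p q × - V ≡ fifth-im p q
norm-fifth-power U V e co co3 eq =
  components (associate-fifth-power α (𝔼-Div.GCD.g d) Nα≢0 (proj₁ factor) (proj₂ factor))
  where
  α : 𝔼
  α = U + - V ω
  d : 𝔼-Div.GCD α (e + 0ℤ ω)
  d = bezout𝔼 α (e + 0ℤ ω)
  product : α *𝔼 ((U + V) + V ω) ≡ (e + 0ℤ ω) ^𝔼 5
  product = trans (cong₂ _+_ω (linear₁ 1ℤ eq (lemma₁ U V (e ^ 5))) (lemma₂ U V)) (sym (embed-fifth e))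
    where
    lemma₁ : ∀ U V E → U * (U + V) - - V * V - E ≡ 1ℤ * (U ^ 2 + U * V + V ^ 2 - E)
    lemma₁ = solve-∀
    lemma₂ : ∀ U V → U * V + - V * (U + V) - - V * V ≡ 0ℤ
    lemma₂ = solve-∀
  factor : ((𝔼-Div.GCD.g d) ^𝔼 5 𝔼-Div.∣ α) × (α 𝔼-Div.∣ (𝔼-Div.GCD.g d) ^𝔼 5)
  factor = 𝔼-Div.coprime-factor-power 4 (coprime-conjugate U V co co3) product d
  Nα≢0 : norm α ≢ 0ℤ
  Nα≢0 Nα≡0 = common-divisor 3 tt co3
    (divides 0ℤ (linear₁ 1ℤ Nα≡0 (lemma U V))) ∣-refl
    where
    lemma : ∀ U V → U ^ 2 + U * V + V ^ 2 - 0ℤ * + 3 ≡ 1ℤ * (U ^ 2 - U * - V + (- V) ^ 2 - 0ℤ)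
    lemma = solve-∀
  components : (∃ λ δ → α ≡ δ ^𝔼 5) → ∃₂ λ p q → U ≡ fifth-re p q × - V ≡ fifth-im p q
  components ((p + q ω) , αeq) = p , q ,
    cong 𝔼.re (trans αeq (fifth-expand p q)) , cong 𝔼.im (trans αeq (fifth-expand p q))

-- The quartic is 1/5 of the cofactor of q′ in the ω-coefficient of (p + q′ω)⁵, at q′ = 5q.
quartic-cofactor : ∀ p q k → Coprime p (+ 5 * q) → (+ 3 ∣ p ^ 2 - + 5 * (p * q) + + 25 * q ^ 2 → ⊥) →
  p ^ 4 - + 10 * (p ^ 3 * q) + + 125 * (p * q ^ 3) - + 125 * q ^ 4 ≡ k ^ 2 → q ≡ 0ℤ
quartic-cofactor p q k co 3∤n eq = [ q-even , q-odd ]′ (2-prime-like q)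
  where
  p⊥5 : Coprime p (+ 5)
  p⊥5 = coprime-∣ʳ (divides q (ℤ.*-comm (+ 5) q)) co
  p⊥q : Coprime p q
  p⊥q = coprime-∣ʳ (divides (+ 5) refl) co
  no-3 : ∀ l → (+ 3 ∣ l → + 3 ∣ + 2 * p - + 5 * q) → Coprime l (+ 3)
  no-3 l to = [ (λ 3∣l → ⊥-elim (3∤n (Modular.modular 3
      (Κ (+ 2) ⊗ Ι 0F ⊕ ⊝ (Κ (+ 5) ⊗ Ι 1F) ∷ [])
      (Ι 0F ⊛ 2 ⊕ ⊝ (Κ (+ 5) ⊗ (Ι 0F ⊗ Ι 1F)) ⊕ Κ (+ 25) ⊗ Ι 1F ⊛ 2) tt
      (p Vec.∷ q Vec.∷ Vec.[]) (to 3∣l All.∷ All.[])))) , id ]′ (3-prime-like l)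
  q-even : + 2 ∣ q → q ≡ 0ℤ
  q-even (divides r qeq) = trans qeq (trans (cong (_* + 2) r≡0) refl)
    where
    p⊥r : Coprime p r
    p⊥r = coprime-∣ʳ (divides (+ 2) (trans qeq (ℤ.*-comm r (+ 2)))) p⊥q
    -- Up to the factor 2, l is the trace of β = p + q′ω with q′ = 5q, namely 2p - q′. The fifth
    -- power of minus the conjugate of β has the same ω-coefficient as β⁵, and this substitution
    -- fixes q′ and changes the sign of l; so the quartic is even in l.
    l : ℤ
    l = p + -[1+ 4 ] * r
    l⊥15r : Coprime l (+ 15 * r)
    l⊥15r = coprime-* (coprime-* {b = + 3} {+ 5}
      (no-3 l λ 3∣l → subst (+ 3 ∣_) {x = + 2 * l}
        (trans (lemma p r) (cong (λ q → + 2 * p - + 5 * q) (sym qeq))) (∣-*ˡ (+ 2) 3∣l))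
      (subst (λ x → Coprime x (+ 5)) {x = p + - r * + 5} {l} (lemma′ p r) (coprime-+ (- r) p⊥5)))
      (coprime-+ -[1+ 4 ] p⊥r)
      where
      lemma : ∀ p r → + 2 * (p + -[1+ 4 ] * r) ≡ + 2 * p - + 5 * (r * + 2)
      lemma = solve-∀
      lemma′ : ∀ p r → p + - r * + 5 ≡ p + -[1+ 4 ] * r
      lemma′ = solve-∀
    r≡0 : r ≡ 0ℤ
    r≡0 = quartic-3 l k r l⊥15r (linear₁ -1ℤ
      (subst (λ q → p ^ 4 - + 10 * (p ^ 3 * q) + + 125 * (p * q ^ 3) - + 125 * q ^ 4 ≡ k ^ 2) qeq eq) (lemma p r k))
      where
      lemma : ∀ p r k → let l = p + -[1+ 4 ] * r ; q = r * + 2 in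
        k ^ 2 - (l ^ 4 - + 150 * (l ^ 2 * r ^ 2) + + 1125 * r ^ 4) ≡
        -1ℤ * (p ^ 4 - + 10 * (p ^ 3 * q) + + 125 * (p * q ^ 3) - + 125 * q ^ 4 - k ^ 2)
      lemma = solve-∀
  q-odd : Coprime q (+ 2) → q ≡ 0ℤ
  -- For odd q the shift 5q/2 is not integral, so l is doubled and the quartic scaled by 16, which
  -- turns the root k into 4k.
  q-odd q⊥2 = quartic-3 l (+ 4 * k) q l⊥15q (linear₁ -[1+ 15 ] eq (lemma p q k))
    where
    l : ℤ
    l = + 2 * p + -[1+ 4 ] * q
    2p⊥ : ∀ {m} → Coprime m (+ 2) → Coprime p m → Coprime (+ 2 * p) m
    2p⊥ m⊥2 p⊥m = coprime-sym (coprime-* m⊥2 (coprime-sym p⊥m))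
    l⊥15q : Coprime l (+ 15 * q)
    l⊥15q = coprime-* (coprime-* {b = + 3} {+ 5}
      (no-3 l λ 3∣l → subst (+ 3 ∣_) {x = l} (lemma p q) 3∣l)
      (subst (λ x → Coprime x (+ 5)) {x = + 2 * p + - q * + 5} {l} (lemma′ p q)
        (coprime-+ (- q) (2p⊥ (coprime 1ℤ -[1+ 1 ] refl) p⊥5))))
      (coprime-+ -[1+ 4 ] (2p⊥ q⊥2 p⊥q))
      where
      lemma : ∀ p q → + 2 * p + -[1+ 4 ] * q ≡ + 2 * p - + 5 * q
      lemma = solve-∀
      lemma′ : ∀ p q → + 2 * p + - q * + 5 ≡ + 2 * p + -[1+ 4 ] * q
      lemma′ = solve-∀
    lemma : ∀ p q k → let l = + 2 * p + -[1+ 4 ] * q in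
      (+ 4 * k) ^ 2 - (l ^ 4 - + 150 * (l ^ 2 * q ^ 2) + + 1125 * q ^ 4) ≡
      -[1+ 15 ] * (p ^ 4 - + 10 * (p ^ 3 * q) + + 125 * (p * q ^ 3) - + 125 * q ^ 4 - k ^ 2)
    lemma = solve-∀

-- Modulo 5 the ω-coefficient of (p + qω)⁵ is -q⁵, so 5 ∣ Y gives q = 5r. Dividing -Y² by 25 leaves
-- y² = -rK with K prime to r, so K is a square up to sign, and `quartic-cofactor` treats the sign
-- +1.
fifth-power-norm-square : ∀ U Y e → Coprime U (Y ^ 2) → + 5 ∣ Y →
  Coprime (U ^ 2 + U * Y ^ 2 + (Y ^ 2) ^ 2) (+ 3) → U ^ 2 + U * Y ^ 2 + (Y ^ 2) ^ 2 ≡ e ^ 5 → Y ≡ 0ℤ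
fifth-power-norm-square U Y e co (divides y Yeq) co3 eq = solve-pq (norm-fifth-power U (Y ^ 2) e co co3 eq)
  where
  solve-pq : (∃₂ λ p q → U ≡ fifth-re p q × - (Y ^ 2) ≡ fifth-im p q) → Y ≡ 0ℤ
  solve-pq (p , q , Ueq , Veq) = divided (Modular.modular 5
      (⊝ ((Ι 2F ⊗ Κ (+ 5)) ⊛ 2) ⊕ ⊝ (Ι 1F ⊗ (Κ (+ 5) ⊗ Ι 0F ⊛ 4 ⊕ ⊝ (Κ (+ 10) ⊗ (Ι 0F ⊛ 3 ⊗ Ι 1F))
        ⊕ Κ (+ 5) ⊗ (Ι 0F ⊗ Ι 1F ⊛ 3) ⊕ ⊝ (Ι 1F ⊛ 4))) ∷ [])
      (Ι 1F) tt (p Vec.∷ q Vec.∷ y Vec.∷ Vec.[]) (≡⇒∣ Veq′ All.∷ All.[]))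
    where
    Veq′ : - ((y * + 5) ^ 2) ≡ fifth-im p q
    Veq′ = subst (λ Y → - (Y ^ 2) ≡ fifth-im p q) Yeq Veq
    p⊥q : Coprime p q
    p⊥q = lift co
      where
      lift : Coprime U (Y ^ 2) → Coprime p q
      -- Both U and Y² lie in the ideal (p, q), so their Bézout identity rearranges into one for p
      -- and q.
      lift (coprime u v identity) = coprime
        (u * (p ^ 4 - + 10 * (p ^ 2 * q ^ 2) + + 10 * (p * q ^ 3)))
        (- u * q ^ 4 - v * (+ 5 * p ^ 4 - + 10 * (p ^ 3 * q) + + 5 * (p * q ^ 3) - q ^ 4))
        (linear₂ 1ℤ 1ℤ identity (cong₂ (λ U V → u * U - v * V) (sym Ueq) (sym Veq)) (lemma u v U (Y ^ 2) p q))
        where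
        lemma : ∀ u v U V p q →
          let U′ = p ^ 5 - + 10 * (p ^ 3 * q ^ 2) + + 10 * (p ^ 2 * q ^ 3) - q ^ 5
              V′ = q * (+ 5 * p ^ 4 - + 10 * (p ^ 3 * q) + + 5 * (p * q ^ 3) - q ^ 4)
          in u * (p ^ 4 - + 10 * (p ^ 2 * q ^ 2) + + 10 * (p * q ^ 3)) * p +
             (- u * q ^ 4 - v * (+ 5 * p ^ 4 - + 10 * (p ^ 3 * q) + + 5 * (p * q ^ 3) - q ^ 4)) * q - 1ℤ ≡
             1ℤ * (u * U + v * V - 1ℤ) + 1ℤ * (u * U′ - v * V′ - (u * U - v * - V))
        lemma = solve-∀
    divided : + 5 ∣ q → Y ≡ 0ℤ
    divided (divides r qeq) = conclude (coprime-power y 1 K⊥-r K*-r)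
      where
      K : ℤ
      K = p ^ 4 - + 10 * (p ^ 3 * r) + + 125 * (p * r ^ 3) - + 125 * r ^ 4
      p⊥5r : Coprime p (+ 5 * r)
      p⊥5r = subst (Coprime p) (trans qeq (ℤ.*-comm r (+ 5))) p⊥q
      K*-r : K * - r ≡ y ^ 2
      K*-r = cancel (+ 25) (λ ()) (linear₁ 1ℤ
        (subst (λ q → - ((y * + 5) ^ 2) ≡ fifth-im p q) qeq Veq′) (lemma p r y))
        where
        lemma : ∀ p r y → let q = r * + 5 in
          + 25 * ((p ^ 4 - + 10 * (p ^ 3 * r) + + 125 * (p * r ^ 3) - + 125 * r ^ 4) * - r) - + 25 * y ^ 2 ≡
          1ℤ * (- ((y * + 5) ^ 2) - q * (+ 5 * p ^ 4 - + 10 * (p ^ 3 * q) + + 5 * (p * q ^ 3) - q ^ 4))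
        lemma = solve-∀
      K⊥-r : Coprime K (- r)
      K⊥-r = subst (λ x → Coprime x (- r)) (lemma p r)
        (coprime-+ (+ 10 * p ^ 3 - + 125 * (p * r ^ 2) + + 125 * r ^ 3)
          (coprime-sym (coprime-^ 3 (coprime-sym (coprime-∣ʳ {b = + 5 * r} (divides -[1+ 4 ] (solve (r ∷ []))) p⊥5r)))))
        where
        lemma : ∀ p r → p ^ 4 + (+ 10 * p ^ 3 - + 125 * (p * r ^ 2) + + 125 * r ^ 3) * - r ≡
          p ^ 4 - + 10 * (p ^ 3 * r) + + 125 * (p * r ^ 3) - + 125 * r ^ 4
        lemma = solve-∀
      3∤n : + 3 ∣ p ^ 2 - + 5 * (p * r) + + 25 * r ^ 2 → ⊥
      3∤n 3∣n = common-divisor 3 tt co3 (subst (+ 3 ∣_) norm≡ (∣-*ˡ (n ^ 4) 3∣n)) ∣-refl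
        where
        n : ℤ
        n = p ^ 2 - + 5 * (p * r) + + 25 * r ^ 2
        lemma : ∀ p r → let q = r * + 5
                            n = p ^ 2 - + 5 * (p * r) + + 25 * r ^ 2
                            U = p ^ 5 - + 10 * (p ^ 3 * q ^ 2) + + 10 * (p ^ 2 * q ^ 3) - q ^ 5
                            V = q * (+ 5 * p ^ 4 - + 10 * (p ^ 3 * q) + + 5 * (p * q ^ 3) - q ^ 4)
          in n ^ 4 * n ≡ U ^ 2 + U * - V + (- V) ^ 2
        lemma = solve-∀
        norm≡ : n ^ 4 * n ≡ U ^ 2 + U * Y ^ 2 + (Y ^ 2) ^ 2
        norm≡ = trans (lemma p r) (cong₂ (λ U V → U ^ 2 + U * V + V ^ 2)
          (trans (cong (fifth-re p) (sym qeq)) (sym Ueq))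
          (trans (cong (λ q → - fifth-im p q) (sym qeq)) (trans (cong -_ (sym Veq)) (ℤ.neg-involutive (Y ^ 2)))))
      conclude : (∃ λ k → K ≡ k ^ 2 ⊎ K ≡ - (k ^ 2)) → Y ≡ 0ℤ
      conclude (k , inj₁ Keq) = trans Yeq (cong (_* + 5) (square-≡0 y (trans (sym K*-r)
        (trans (cong (λ r → K * - r) (quartic-cofactor p r k p⊥5r 3∤n Keq)) (ℤ.*-zeroʳ K)))))
      -- Modulo 3, K ≡ (p - r)⁴ while the norm p² - 5pr + 25r² ≡ (p - r)². As -1 is no square, K =
      -- -k² forces p ≡ r, so 3 divides the norm.
      conclude (k , inj₂ Keq) = ⊥-elim (3∤n (Modular.modular 3
        (Ι 0F ⊛ 4 ⊕ ⊝ (Κ (+ 10) ⊗ (Ι 0F ⊛ 3 ⊗ Ι 1F)) ⊕ Κ (+ 125) ⊗ (Ι 0F ⊗ Ι 1F ⊛ 3) ⊕ ⊝ (Κ (+ 125) ⊗ Ι 1F ⊛ 4)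
          ⊕ ⊝ (⊝ (Ι 2F ⊛ 2)) ∷ [])
        (Ι 0F ⊛ 2 ⊕ ⊝ (Κ (+ 5) ⊗ (Ι 0F ⊗ Ι 1F)) ⊕ Κ (+ 25) ⊗ Ι 1F ⊛ 2) tt
        (p Vec.∷ r Vec.∷ k Vec.∷ Vec.[]) (≡⇒∣ Keq All.∷ All.[])))

-- The homogeneous equation

-- a²⁵ ≡ a⁵ mod 25, since units have order dividing 20. This turns being a fifth power into a
-- condition on x itself, so the enumerations below run over 25² pairs with no variables for the
-- roots.
fifth-power-mod-25 : ∀ {x} → (∃ λ a → x ≡ a ^ 5) → + 25 ∣ x ^ 5 - x
fifth-power-mod-25 (a , refl) = Modular.modular 25 [] ((Ι 0F ⊛ 5) ⊛ 5 ⊕ ⊝ (Ι 0F ⊛ 5)) tt (a Vec.∷ Vec.[]) All.[]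

sum-coprimeˡ : ∀ {X Y} → Coprime X Y → Coprime (X + Y) X
sum-coprimeˡ {X} {Y} co = subst (λ s → Coprime s X) (lemma X Y) (coprime-+ 1ℤ (coprime-sym co))
  where
  lemma : ∀ X Y → Y + 1ℤ * X ≡ X + Y
  lemma = solve-∀

sum-coprimeʳ : ∀ {X Y} → Coprime X Y → Coprime (X + Y) Y
sum-coprimeʳ {X} {Y} co = subst (λ s → Coprime s Y) (lemma X Y) (coprime-+ 1ℤ co)
  where
  lemma : ∀ X Y → X + 1ℤ * Y ≡ X + Y
  lemma = solve-∀

square-coprime : ∀ {a b} → Coprime a b → Coprime (a ^ 2) b
square-coprime co = coprime-sym (coprime-^ 1 (coprime-sym co))

module Coprime-to-3 (X Y N : ℤ) (co : Coprime X Y) (3⊥s : Coprime (X + Y) (+ 3))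
  (eq : (X + Y) * ((X ^ 2 + X * Y + Y ^ 2) * (X ^ 2 - X * Y + Y ^ 2)) ≡ N ^ 5) where

  s B D : ℤ
  s = X + Y
  B = X ^ 2 + X * Y + Y ^ 2
  D = X ^ 2 - X * Y + Y ^ 2

  s⊥XY : Coprime s (X * Y)
  s⊥XY = coprime-* (sum-coprimeˡ co) (sum-coprimeʳ co)

  s⊥B : Coprime s B
  s⊥B = coprime-sym (subst (λ t → Coprime t s) (lemma X Y)
    (coprime-+ s (coprime-∣ʳ-neg (coprime-sym s⊥XY))))
    where
    coprime-∣ʳ-neg : ∀ {a b} → Coprime a b → Coprime (-1ℤ * a) b
    coprime-∣ʳ-neg {a} {b} (coprime u v identity) = coprime (- u) v
      (linear₁ 1ℤ identity (solve (a ∷ b ∷ u ∷ v ∷ [])))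
    lemma : ∀ X Y → -1ℤ * (X * Y) + (X + Y) * (X + Y) ≡ X ^ 2 + X * Y + Y ^ 2
    lemma = solve-∀

  -- D = s² - 3XY, so 3 is the only prime that s and D could share.
  s⊥D : Coprime s D
  s⊥D = coprime-sym (subst (λ t → Coprime t s) (lemma X Y)
    (coprime-+ s (coprime-sym (coprime-* (coprime-∣ʳ {c = -[1+ 2 ]} (divides -1ℤ refl) 3⊥s) s⊥XY))))
    where
    lemma : ∀ X Y → -[1+ 2 ] * (X * Y) + (X + Y) * (X + Y) ≡ X ^ 2 - X * Y + Y ^ 2
    lemma = solve-∀

  B⊥X : Coprime B X
  B⊥X = subst (λ t → Coprime t X) (lemma X Y) (coprime-+ (X + Y) (square-coprime (coprime-sym co)))
    where
    lemma : ∀ X Y → Y ^ 2 + (X + Y) * X ≡ X ^ 2 + X * Y + Y ^ 2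
    lemma = solve-∀

  B⊥Y : Coprime B Y
  B⊥Y = subst (λ t → Coprime t Y) (lemma X Y) (coprime-+ (X + Y) (square-coprime co))
    where
    lemma : ∀ X Y → X ^ 2 + (X + Y) * Y ≡ X ^ 2 + X * Y + Y ^ 2
    lemma = solve-∀

  B⊥2 : Coprime B (+ 2)
  B⊥2 = [ (λ 2∣B → ⊥-elim (common-divisor 2 tt co (residue (Ι 0F) tt 2∣B) (residue (Ι 1F) tt 2∣B))) , id ]′
    (2-prime-like B)
    where
    residue : (c : Expr ℤ 2) → T (Modular.allResidues 2 2 (Modular.follows 2
      (Ι 0F ⊛ 2 ⊕ Ι 0F ⊗ Ι 1F ⊕ Ι 1F ⊛ 2 ∷ []) c)) → + 2 ∣ B → + 2 ∣ Ops.⟦ c ⟧ (X Vec.∷ Y Vec.∷ Vec.[])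
    residue c ok 2∣B = Modular.modular 2 (Ι 0F ⊛ 2 ⊕ Ι 0F ⊗ Ι 1F ⊕ Ι 1F ⊛ 2 ∷ []) c ok
      (X Vec.∷ Y Vec.∷ Vec.[]) (2∣B All.∷ All.[])

  B⊥D : Coprime B D
  B⊥D = coprime-sym (subst (λ t → Coprime t B) (lemma X Y)
    (coprime-+ 1ℤ (coprime-sym (coprime-* {b = -[1+ 1 ]} (coprime-∣ʳ (divides -1ℤ refl) B⊥2) (coprime-* B⊥X B⊥Y)))))
    where
    lemma : ∀ X Y → -[1+ 1 ] * (X * Y) + 1ℤ * (X ^ 2 + X * Y + Y ^ 2) ≡ X ^ 2 - X * Y + Y ^ 2
    lemma = solve-∀

  s-fifth : ∃ λ a → s ≡ a ^ 5
  s-fifth = coprime-fifth-power N (coprime-* s⊥B s⊥D) eq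

  BD-fifth : ∃ λ e → B * D ≡ e ^ 5
  BD-fifth = coprime-fifth-power N (coprime-sym (coprime-* s⊥B s⊥D)) (trans (ℤ.*-comm (B * D) s) eq)

  B-fifth : ∃ λ b → B ≡ b ^ 5
  B-fifth = let e , BD≡e⁵ = BD-fifth in coprime-fifth-power e B⊥D BD≡e⁵

  D-fifth : ∃ λ d → D ≡ d ^ 5
  D-fifth = let e , BD≡e⁵ = BD-fifth in coprime-fifth-power e (coprime-sym B⊥D) (trans (ℤ.*-comm D B) BD≡e⁵)

  5∣XY : + 5 ∣ X * Y
  5∣XY = cancel-∣ (+ 5) (λ ()) (Modular.modular 25
    (fixed (Ι 0F ⊕ Ι 1F) ∷ fixed (Ι 0F ⊛ 2 ⊕ Ι 0F ⊗ Ι 1F ⊕ Ι 1F ⊛ 2) ∷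
      fixed (Ι 0F ⊛ 2 ⊕ ⊝ (Ι 0F ⊗ Ι 1F) ⊕ Ι 1F ⊛ 2) ∷ [])
    (Κ (+ 5) ⊗ (Ι 0F ⊗ Ι 1F)) tt (X Vec.∷ Y Vec.∷ Vec.[])
    (fifth-power-mod-25 s-fifth All.∷ fifth-power-mod-25 B-fifth All.∷ fifth-power-mod-25 D-fifth All.∷ All.[]))
    where
    fixed : Expr ℤ 2 → Expr ℤ 2
    fixed x = x ⊛ 5 ⊕ ⊝ x

  -- D ≡ (X + Y)² mod 3 is prime to 3. If 3 ∣ B, then X ≡ Y mod 3 with neither divisible by 3, and B
  -- = (X - Y)² + 3XY is divisible by 3 exactly once, which is impossible for a fifth power.
  BD⊥3 : Coprime (B * D) (+ 3)
  BD⊥3 = [ (λ 3∣BD → ⊥-elim (contradict B-fifth 3∣BD)) , id ]′ (3-prime-like (B * D))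
    where
    contradict : (∃ λ b → B ≡ b ^ 5) → + 3 ∣ B * D → ⊥
    contradict (b , Beq) 3∣BD = common-divisor 3 tt 3⊥s (cancel-∣ (+ 3) (λ ()) (Modular.modular 9
      (Bₑ ⊕ ⊝ (Ι 2F ⊛ 5) ∷ Κ (+ 3) ⊗ (Bₑ ⊗ (Ι 0F ⊛ 2 ⊕ ⊝ (Ι 0F ⊗ Ι 1F) ⊕ Ι 1F ⊛ 2)) ∷ [])
      (Κ (+ 3) ⊗ (Ι 0F ⊕ Ι 1F)) tt (X Vec.∷ Y Vec.∷ b Vec.∷ Vec.[])
      (≡⇒∣ Beq All.∷ ∣-* (∣-refl {+ 3}) 3∣BD All.∷ All.[]))) ∣-refl
      where
      Bₑ : Expr ℤ 3
      Bₑ = Ι 0F ⊛ 2 ⊕ Ι 0F ⊗ Ι 1F ⊕ Ι 1F ⊛ 2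

  squares-norm : ∀ X Y → (X ^ 2 + X * Y + Y ^ 2) * (X ^ 2 - X * Y + Y ^ 2) ≡
    (X ^ 2) ^ 2 + X ^ 2 * Y ^ 2 + (Y ^ 2) ^ 2
  squares-norm = solve-∀

  squares-norm′ : ∀ X Y → (X ^ 2 + X * Y + Y ^ 2) * (X ^ 2 - X * Y + Y ^ 2) ≡
    (Y ^ 2) ^ 2 + Y ^ 2 * X ^ 2 + (X ^ 2) ^ 2
  squares-norm′ = solve-∀

  trivial : X ≡ 0ℤ ⊎ Y ≡ 0ℤ
  trivial = by-e BD-fifth
    where
    by-e : (∃ λ e → B * D ≡ e ^ 5) → X ≡ 0ℤ ⊎ Y ≡ 0ℤ
    by-e (e , BDeq) = [ (λ 5∣X → inj₁ (left 5∣X)) , (λ X⊥5 → inj₂ (right (coprime-divisor (coprime-sym X⊥5) 5∣XY))) ]′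
      (5-prime-like X)
      where
      left : + 5 ∣ X → X ≡ 0ℤ
      left 5∣X = fifth-power-norm-square (Y ^ 2) X e (coprime-^ 1 (square-coprime (coprime-sym co))) 5∣X
        (subst (λ t → Coprime t (+ 3)) (squares-norm′ X Y) BD⊥3) (trans (sym (squares-norm′ X Y)) BDeq)
      right : + 5 ∣ Y → Y ≡ 0ℤ
      right 5∣Y = fifth-power-norm-square (X ^ 2) Y e (coprime-^ 1 (square-coprime co)) 5∣Y
        (subst (λ t → Coprime t (+ 3)) (squares-norm X Y) BD⊥3) (trans (sym (squares-norm X Y)) BDeq)

-- Here X + Y = 3 s; the factors B and D are X² + XY + Y² and (X² - XY + Y²) / 3.
module Divisible-by-3 (s Y N : ℤ) (co : Coprime (+ 3 * s) Y)
  (eq : + 9 * s * ((+ 9 * s ^ 2 - + 3 * (s * Y) + Y ^ 2) * (+ 3 * s ^ 2 - + 3 * (s * Y) + Y ^ 2)) ≡ N ^ 5) where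

  B D : ℤ
  B = + 9 * s ^ 2 - + 3 * (s * Y) + Y ^ 2
  D = + 3 * s ^ 2 - + 3 * (s * Y) + Y ^ 2

  s⊥Y : Coprime s Y
  s⊥Y = coprime-∣ (divides (+ 3) refl) ∣-refl co

  Y²⊥3s : Coprime (Y ^ 2) (+ 3 * s)
  Y²⊥3s = square-coprime (coprime-sym co)

  B⊥3s : Coprime B (+ 3 * s)
  B⊥3s = subst (λ t → Coprime t (+ 3 * s)) (lemma s Y) (coprime-+ (+ 3 * s - Y) Y²⊥3s)
    where
    lemma : ∀ s Y → Y ^ 2 + (+ 3 * s - Y) * (+ 3 * s) ≡ + 9 * s ^ 2 - + 3 * (s * Y) + Y ^ 2
    lemma = solve-∀

  D⊥3s : Coprime D (+ 3 * s)
  D⊥3s = subst (λ t → Coprime t (+ 3 * s)) (lemma s Y) (coprime-+ (s - Y) Y²⊥3s)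
    where
    lemma : ∀ s Y → Y ^ 2 + (s - Y) * (+ 3 * s) ≡ + 3 * s ^ 2 - + 3 * (s * Y) + Y ^ 2
    lemma = solve-∀

  9s⊥ : ∀ {a} → Coprime a (+ 3 * s) → Coprime (+ 9 * s) a
  9s⊥ a⊥3s = coprime-sym (coprime-∣ʳ {b = (+ 3 * s) ^ 2} (divides s (solve (s ∷ []))) (coprime-^ 1 a⊥3s))

  odd : ∀ c → T (Modular.allResidues 2 2 (Modular.follows 2 (c ∷ []) (Ι 0F))) →
    T (Modular.allResidues 2 2 (Modular.follows 2 (c ∷ []) (Ι 1F))) → Coprime (Ops.⟦ c ⟧ (s Vec.∷ Y Vec.∷ Vec.[])) (+ 2)
  odd c ok ok′ = [ (λ 2∣c → ⊥-elim (common-divisor 2 tt s⊥Y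
      (Modular.modular 2 (c ∷ []) (Ι 0F) ok (s Vec.∷ Y Vec.∷ Vec.[]) (2∣c All.∷ All.[]))
      (Modular.modular 2 (c ∷ []) (Ι 1F) ok′ (s Vec.∷ Y Vec.∷ Vec.[]) (2∣c All.∷ All.[])))) , id ]′
    (2-prime-like (Ops.⟦ c ⟧ (s Vec.∷ Y Vec.∷ Vec.[])))

  Bₑ Dₑ : Expr ℤ 2
  Bₑ = Κ (+ 9) ⊗ Ι 0F ⊛ 2 ⊕ ⊝ (Κ (+ 3) ⊗ (Ι 0F ⊗ Ι 1F)) ⊕ Ι 1F ⊛ 2
  Dₑ = Κ (+ 3) ⊗ Ι 0F ⊛ 2 ⊕ ⊝ (Κ (+ 3) ⊗ (Ι 0F ⊗ Ι 1F)) ⊕ Ι 1F ⊛ 2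

  B⊥2 : Coprime B (+ 2)
  B⊥2 = odd Bₑ tt tt

  D⊥2 : Coprime D (+ 2)
  D⊥2 = odd Dₑ tt tt

  B⊥D : Coprime B D
  B⊥D = subst (λ t → Coprime t D) (lemma s Y) (coprime-+ 1ℤ (coprime-sym
    (coprime-* (coprime-* D⊥2 D⊥3s) (coprime-∣ʳ (divides (+ 3) refl) D⊥3s))))
    where
    lemma : ∀ s Y → + 2 * (+ 3 * s) * s + 1ℤ * (+ 3 * s ^ 2 - + 3 * (s * Y) + Y ^ 2) ≡
      + 9 * s ^ 2 - + 3 * (s * Y) + Y ^ 2
    lemma = solve-∀

  9s⊥BD : Coprime (+ 9 * s) (B * D)
  9s⊥BD = coprime-* (9s⊥ B⊥3s) (9s⊥ D⊥3s)

  9s-fifth : ∃ λ f → + 9 * s ≡ f ^ 5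
  9s-fifth = coprime-fifth-power N 9s⊥BD eq

  BD-fifth : ∃ λ e → B * D ≡ e ^ 5
  BD-fifth = coprime-fifth-power N (coprime-sym 9s⊥BD) (trans (ℤ.*-comm (B * D) (+ 9 * s)) eq)

  B-fifth : ∃ λ b → B ≡ b ^ 5
  B-fifth = let e , BD≡e⁵ = BD-fifth in coprime-fifth-power e B⊥D BD≡e⁵

  D-fifth : ∃ λ d → D ≡ d ^ 5
  D-fifth = let e , BD≡e⁵ = BD-fifth in coprime-fifth-power e (coprime-sym B⊥D) (trans (ℤ.*-comm D B) BD≡e⁵)

  5∣s : + 5 ∣ s
  5∣s = cancel-∣ (+ 5) (λ ()) (Modular.modular 25 (fixed (Κ (+ 9) ⊗ Ι 0F) ∷ fixed Bₑ ∷ fixed Dₑ ∷ [])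
    (Κ (+ 5) ⊗ Ι 0F) tt (s Vec.∷ Y Vec.∷ Vec.[])
    (fifth-power-mod-25 9s-fifth All.∷ fifth-power-mod-25 B-fifth All.∷ fifth-power-mod-25 D-fifth All.∷ All.[]))
    where
    fixed : Expr ℤ 2 → Expr ℤ 2
    fixed x = x ⊛ 5 ⊕ ⊝ x

  difference : ∀ b d → B ≡ b ^ 5 → D ≡ d ^ 5 → b ^ 5 - d ^ 5 ≡ + 6 * s ^ 2
  difference b d Beq Deq = trans (cong₂ _-_ (sym Beq) (sym Deq)) (lemma s Y)
    where
    lemma : ∀ s Y → + 9 * s ^ 2 - + 3 * (s * Y) + Y ^ 2 - (+ 3 * s ^ 2 - + 3 * (s * Y) + Y ^ 2) ≡ + 6 * s ^ 2
    lemma = solve-∀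

  -- The left side is 2δ(5σ⁴ + 10σ²δ² + δ⁴) ≡ 2δ⁵ mod 5, so 5 ∣ δ. With δ = 5ε a factor 50 cancels
  -- and leaves εQ = 3t².
  root-of-difference : ∀ σ δ t → Coprime σ δ → (σ + δ) ^ 5 - (σ - δ) ^ 5 ≡ + 6 * (t * + 5) ^ 2 → t ≡ 0ℤ
  root-of-difference σ δ t co eq = divided (Modular.modular 5
      ((Ι 0F ⊕ Ι 1F) ⊛ 5 ⊕ ⊝ ((Ι 0F ⊕ ⊝ Ι 1F) ⊛ 5) ⊕ ⊝ (Κ (+ 6) ⊗ (Ι 2F ⊗ Κ (+ 5)) ⊛ 2) ∷ []) (Ι 1F) tt
      (σ Vec.∷ δ Vec.∷ t Vec.∷ Vec.[]) (≡⇒∣ eq All.∷ All.[]))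
    where
    divided : + 5 ∣ δ → t ≡ 0ℤ
    divided (divides ε δeq) = conclude (coprime-power (+ 3 * t) 1 Q⊥3ε Q3ε)
      where
      Q : ℤ
      Q = σ ^ 4 + + 50 * (σ ^ 2 * ε ^ 2) + + 125 * ε ^ 4
      -- A further factor 3 completes 3t² to a square; the coprimality needed for splitting it
      -- survives because Q is prime to 3.
      Q3ε : Q * (+ 3 * ε) ≡ (+ 3 * t) ^ 2
      Q3ε = cancel (+ 50) (λ ()) (linear₁ (+ 3)
        (subst (λ δ → (σ + δ) ^ 5 - (σ - δ) ^ 5 ≡ + 6 * (t * + 5) ^ 2) δeq eq) (lemma σ ε t))
        where
        lemma : ∀ σ ε t → let δ = ε * + 5 in
          + 50 * ((σ ^ 4 + + 50 * (σ ^ 2 * ε ^ 2) + + 125 * ε ^ 4) * (+ 3 * ε)) - + 50 * (+ 3 * t) ^ 2 ≡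
          + 3 * ((σ + δ) ^ 5 - (σ - δ) ^ 5 - + 6 * (t * + 5) ^ 2)
        lemma = solve-∀
      σ⊥5ε : Coprime σ (+ 5 * ε)
      σ⊥5ε = subst (Coprime σ) (trans δeq (ℤ.*-comm ε (+ 5))) co
      σ⊥ε : Coprime σ ε
      σ⊥ε = coprime-∣ʳ (divides (+ 5) refl) σ⊥5ε
      Qₑ : Expr ℤ 2
      Qₑ = Ι 0F ⊛ 4 ⊕ Κ (+ 50) ⊗ (Ι 0F ⊛ 2 ⊗ Ι 1F ⊛ 2) ⊕ Κ (+ 125) ⊗ Ι 1F ⊛ 4
      Q⊥3 : Coprime Q (+ 3)
      Q⊥3 = [ (λ 3∣Q → ⊥-elim (common-divisor 3 tt σ⊥ε
          (Modular.modular 3 (Qₑ ∷ []) (Ι 0F) tt (σ Vec.∷ ε Vec.∷ Vec.[]) (3∣Q All.∷ All.[]))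
          (Modular.modular 3 (Qₑ ∷ []) (Ι 1F) tt (σ Vec.∷ ε Vec.∷ Vec.[]) (3∣Q All.∷ All.[])))) , id ]′
        (3-prime-like Q)
      Q⊥ε : Coprime Q ε
      Q⊥ε = subst (λ t → Coprime t ε) (lemma σ ε)
        (coprime-+ (+ 50 * (σ ^ 2 * ε) + + 125 * ε ^ 3) (coprime-sym (coprime-^ 3 (coprime-sym σ⊥ε))))
        where
        lemma : ∀ σ ε → σ ^ 4 + (+ 50 * (σ ^ 2 * ε) + + 125 * ε ^ 3) * ε ≡
          σ ^ 4 + + 50 * (σ ^ 2 * ε ^ 2) + + 125 * ε ^ 4
        lemma = solve-∀
      Q⊥3ε : Coprime Q (+ 3 * ε)
      Q⊥3ε = coprime-* Q⊥3 Q⊥ε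
      conclude : (∃ λ y → Q ≡ y ^ 2 ⊎ Q ≡ - (y ^ 2)) → t ≡ 0ℤ
      conclude (y , inj₁ Qeq) = cancel (+ 3) (λ ()) (square-≡0 (+ 3 * t) (trans (sym Q3ε)
        (trans (cong (λ ε → Q * (+ 3 * ε)) ε≡0) (ℤ.*-zeroʳ Q))))
        where
        ε≡0 : ε ≡ 0ℤ
        ε≡0 = quartic-1 σ y ε σ⊥5ε (sym Qeq)
      -- Q is a sum of nonnegative terms, so the sign -1 would force σ = 0, against its coprimality
      -- to 5.
      conclude (y , inj₂ Qeq) = ⊥-elim (common-divisor 5 tt σ⊥5ε
        (subst (+ 5 ∣_) (sym σ≡0) (divides 0ℤ refl)) (divides ε (ℤ.*-comm (+ 5) ε)))
        where
        σ≡0 : σ ≡ 0ℤ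
        σ≡0 = square-≡0 σ (square-≡0 (σ ^ 2) (nonneg-sum (square-nonneg (σ ^ 2))
          (nonneg-+ (nonneg-* 50 (square-nonneg (σ * ε)))
            (nonneg-+ (nonneg-* 125 (square-nonneg (ε ^ 2))) (square-nonneg y)))
          (linear₁ 1ℤ Qeq (lemma σ ε y))))
          where
          lemma : ∀ σ ε y → (σ ^ 2) ^ 2 + (+ 50 * (σ * ε) ^ 2 + (+ 125 * (ε ^ 2) ^ 2 + y ^ 2)) - 0ℤ ≡
            1ℤ * (σ ^ 4 + + 50 * (σ ^ 2 * ε ^ 2) + + 125 * ε ^ 4 - - (y ^ 2))
          lemma = solve-∀

  s≡0 : s ≡ 0ℤ
  s≡0 = by-roots B-fifth D-fifth 5∣s
    where
    by-roots : (∃ λ b → B ≡ b ^ 5) → (∃ λ d → D ≡ d ^ 5) → + 5 ∣ s → s ≡ 0ℤ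
    -- bd(b - d) is even for all integers; as b and d divide the odd numbers B and D, the 2 divides
    -- b - d and the substitution b = σ + δ, d = σ - δ is integral.
    by-roots (b , Beq) (d , Deq) (divides t seq) = halve (coprime-divisor (coprime-* (coprime-sym b⊥2) (coprime-sym d⊥2))
        (Modular.modular 2 [] (Ι 0F ⊗ Ι 1F ⊗ (Ι 0F ⊕ ⊝ Ι 1F)) tt (b Vec.∷ d Vec.∷ Vec.[]) All.[]))
      where
      b∣B : b ∣ B
      b∣B = divides (b ^ 4) Beq
      d∣D : d ∣ D
      d∣D = divides (d ^ 4) Deq
      b⊥2 : Coprime b (+ 2)
      b⊥2 = coprime-∣ b∣B ∣-refl B⊥2
      d⊥2 : Coprime d (+ 2)
      d⊥2 = coprime-∣ d∣D ∣-refl D⊥2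
      halve : + 2 ∣ b - d → s ≡ 0ℤ
      halve (divides δ b-d≡) = trans seq (cong (_* + 5) (root-of-difference (d + δ) δ t σ⊥δ
        (subst₂ (λ x y → x ^ 5 - y ^ 5 ≡ + 6 * (t * + 5) ^ 2) b≡ (lemma d δ)
          (trans (difference b d Beq Deq) (cong (λ s → + 6 * s ^ 2) seq)))))
        where
        lemma : ∀ d δ → d ≡ d + δ - δ
        lemma = solve-∀
        b≡ : b ≡ d + δ + δ
        b≡ = linear₁ 1ℤ b-d≡ (solve (b ∷ d ∷ δ ∷ []))
        σ⊥δ : Coprime (d + δ) δ
        σ⊥δ = lift (coprime-∣ b∣B d∣D B⊥D)
          where
          lift : Coprime b d → Coprime (d + δ) δ
          lift (coprime u v identity) = coprime (u + v) (u - v)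
            (linear₂ 1ℤ (- u) identity b≡ (solve (u ∷ v ∷ b ∷ d ∷ δ ∷ [])))

sextic-trivial : ∀ X Y N → Coprime X Y → N ≢ 0ℤ →
  (X + Y) * ((X ^ 2 + X * Y + Y ^ 2) * (X ^ 2 - X * Y + Y ^ 2)) ≡ N ^ 5 → X ≡ 0ℤ ⊎ Y ≡ 0ℤ
sextic-trivial X Y N co N≢0 eq = [ divisible , (λ ⊥3 → Coprime-to-3.trivial X Y N co ⊥3 eq) ]′ (3-prime-like (X + Y))
  where
  divisible : + 3 ∣ X + Y → X ≡ 0ℤ ⊎ Y ≡ 0ℤ
  -- With s = 0 the whole left side vanishes, so N would be zero.
  divisible (divides s X+Y≡) = contradiction (ℤ.i^n≡0⇒i≡0 N 5 (trans (N^5 N) (trans (sym eq′)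
    (cong (λ s → + 9 * s * ((+ 9 * s ^ 2 - + 3 * (s * Y) + Y ^ 2) * (+ 3 * s ^ 2 - + 3 * (s * Y) + Y ^ 2)))
      (Divisible-by-3.s≡0 s Y N co′ eq′))))) N≢0
    where
    N^5 : ∀ N → N ℤ.^ 5 ≡ N ^ 5
    N^5 N = lemma N
      where
      lemma : ∀ N → N * (N * (N * (N * (N * 1ℤ)))) ≡ N ^ 5
      lemma = solve-∀
    X≡ : X ≡ + 3 * s - Y
    X≡ = linear₁ 1ℤ X+Y≡ (solve (X ∷ Y ∷ s ∷ []))
    co′ : Coprime (+ 3 * s) Y
    co′ = subst (λ t → Coprime t Y) (trans X+Y≡ (ℤ.*-comm s (+ 3))) (sum-coprimeʳ co)
    eq′ : + 9 * s * ((+ 9 * s ^ 2 - + 3 * (s * Y) + Y ^ 2) * (+ 3 * s ^ 2 - + 3 * (s * Y) + Y ^ 2)) ≡ N ^ 5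
    eq′ = trans (lemma s Y) (trans
      (cong (λ X → (X + Y) * ((X ^ 2 + X * Y + Y ^ 2) * (X ^ 2 - X * Y + Y ^ 2))) (sym X≡)) eq)
      where
      lemma : ∀ s Y → let X = + 3 * s - Y in
        + 9 * s * ((+ 9 * s ^ 2 - + 3 * (s * Y) + Y ^ 2) * (+ 3 * s ^ 2 - + 3 * (s * Y) + Y ^ 2)) ≡
        (X + Y) * ((X ^ 2 + X * Y + Y ^ 2) * (X ^ 2 - X * Y + Y ^ 2))
      lemma = solve-∀

-- Reduction of the homogeneous equation to coprime integers

record Reduction (a b : ℤ) : Set where
  constructor reduction
  field
    d a′ b′   : ℤ
    a≡        : a ≡ a′ * d
    b≡        : b ≡ b′ * d
    a′⊥b′     : Coprime a′ b′

reduce : ∀ a b → (a ≡ 0ℤ → b ≢ 0ℤ) → Reduction a b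
reduce a b nonzero = divided (bezoutℤ a b)
  where
  divided : GCD a b → Reduction a b
  divided (gcd g (divides a′ a≡) (divides b′ b≡) u v identity) = reduction g a′ b′ a≡ b≡
    (coprime u v (cancel g g≢0 (linear₁ 1ℤ
      (trans (sym (cong₂ (λ x y → u * x + v * y) a≡ b≡)) identity) (solve (g ∷ a′ ∷ b′ ∷ u ∷ v ∷ [])))))
    where
    g≢0 : g ≢ 0ℤ
    g≢0 refl = nonzero (trans a≡ (ℤ.*-zeroʳ a′)) (trans b≡ (ℤ.*-zeroʳ b′))

fifth-power≢0 : ∀ {a} → a ≢ 0ℤ → a ^ 5 ≢ 0ℤ
fifth-power≢0 {a} a≢0 = ≢0-* (a ^ 4) a (≢0-* (a ^ 3) a (≢0-* (a ^ 2) a (≢0-* a a a≢0 a≢0) a≢0) a≢0) a≢0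

-- A rational number with an integral fifth power is integral: in lowest terms N/a = N′/a′, the
-- denominator a′ divides N′⁵ and is prime to it, so it is a unit.
fifth-power-quotient : ∀ a F N → a ≢ 0ℤ → a ^ 5 * F ≡ N ^ 5 → ∃ λ M → F ≡ M ^ 5
fifth-power-quotient a F N a≢0 eq = reduced (reduce a N (λ a≡0 _ → a≢0 a≡0))
  where
  reduced : Reduction a N → ∃ λ M → F ≡ M ^ 5
  -- As a′ is 1 or -1, the quotient N′/a′ is the product a′N′.
  reduced (reduction d a′ N′ a≡ N≡ co) = a′ * N′ ,
    [ positive , negative ]′ (associates a′ 1ℤ a′∣1 (divides a′ (sym (ℤ.*-identityʳ a′))))
    where
    d≢0 : d ≢ 0ℤ
    d≢0 = ≢0-factorʳ a′ d (sym a≡) a≢0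
    eq′ : a′ ^ 5 * F ≡ N′ ^ 5
    eq′ = cancel (d ^ 5) (fifth-power≢0 d≢0) (linear₁ 1ℤ
      (subst₂ (λ a N → a ^ 5 * F ≡ N ^ 5) a≡ N≡ eq) (lemma a′ N′ d F))
      where
      lemma : ∀ a N d F → d ^ 5 * (a ^ 5 * F) - d ^ 5 * N ^ 5 ≡ 1ℤ * ((a * d) ^ 5 * F - (N * d) ^ 5)
      lemma = solve-∀
    a′∣1 : a′ ∣ 1ℤ
    a′∣1 = coprime-divisor {b = N′ ^ 5} (coprime-^ 4 co) (divides (a′ ^ 4 * F) (linear₁ -1ℤ eq′ (lemma a′ N′ F)))
      where
      lemma : ∀ a N F → N ^ 5 * 1ℤ - a ^ 4 * F * a ≡ -1ℤ * (a ^ 5 * F - N ^ 5)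
      lemma = solve-∀
    positive : a′ ≡ 1ℤ → F ≡ (a′ * N′) ^ 5
    positive refl = linear₁ 1ℤ eq′ (lemma N′ F)
      where
      lemma : ∀ N F → F - (1ℤ * N) ^ 5 ≡ 1ℤ * (1ℤ ^ 5 * F - N ^ 5)
      lemma = solve-∀
    negative : a′ ≡ -1ℤ → F ≡ (a′ * N′) ^ 5
    negative refl = linear₁ -1ℤ eq′ (lemma N′ F)
      where
      lemma : ∀ N F → F - (-1ℤ * N) ^ 5 ≡ -1ℤ * (-1ℤ ^ 5 * F - N ^ 5)
      lemma = solve-∀

-- The form has degree 5, the exponent of N: a common divisor g of X and Y contributes exactly g⁵,
-- which is cancelled against N⁵ without any assumption on gcd(g, N).
homogeneous-trivial : ∀ X Y N → N ≢ 0ℤ →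
  (X + Y) * (X ^ 4 + X ^ 2 * Y ^ 2 + Y ^ 4) + N ^ 5 ≡ 0ℤ → X ≡ 0ℤ ⊎ Y ≡ 0ℤ
homogeneous-trivial X Y N N≢0 eq = reduced (reduce X Y nonzero)
  where
  Goal : Set
  Goal = X ≡ 0ℤ ⊎ Y ≡ 0ℤ
  nonzero : X ≡ 0ℤ → Y ≢ 0ℤ
  nonzero X≡0 Y≡0 = fifth-power≢0 N≢0 (linear₁ 1ℤ
    (trans (cong₂ (λ X Y → (X + Y) * (X ^ 4 + X ^ 2 * Y ^ 2 + Y ^ 4) + N ^ 5) (sym X≡0) (sym Y≡0)) eq) (lemma (N ^ 5)))
    where
    lemma : ∀ M → M - 0ℤ ≡ 1ℤ * ((0ℤ + 0ℤ) * (0ℤ ^ 4 + 0ℤ ^ 2 * 0ℤ ^ 2 + 0ℤ ^ 4) + M - 0ℤ)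
    lemma = solve-∀
  reduced : Reduction X Y → Goal
  reduced (reduction g x y X≡ Y≡ co) = quotient (fifth-power-quotient g F (- N) g≢0 eq′)
    where
    F : ℤ
    F = (x + y) * ((x ^ 2 + x * y + y ^ 2) * (x ^ 2 - x * y + y ^ 2))
    g≢0 : g ≢ 0ℤ
    g≢0 g≡0 = nonzero (trans X≡ (trans (cong (x *_) g≡0) (ℤ.*-zeroʳ x)))
      (trans Y≡ (trans (cong (y *_) g≡0) (ℤ.*-zeroʳ y)))
    eq′ : g ^ 5 * F ≡ (- N) ^ 5
    eq′ = linear₁ 1ℤ
      (trans (cong₂ (λ X Y → (X + Y) * (X ^ 4 + X ^ 2 * Y ^ 2 + Y ^ 4) + N ^ 5) (sym X≡) (sym Y≡)) eq)
      (lemma g x y N)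
      where
      lemma : ∀ g x y N → g ^ 5 * ((x + y) * ((x ^ 2 + x * y + y ^ 2) * (x ^ 2 - x * y + y ^ 2))) - (- N) ^ 5 ≡
        1ℤ * ((x * g + y * g) * ((x * g) ^ 4 + (x * g) ^ 2 * (y * g) ^ 2 + (y * g) ^ 4) + N ^ 5 - 0ℤ)
      lemma = solve-∀
    quotient : (∃ λ M → F ≡ M ^ 5) → Goal
    quotient (M , Feq) = [ (λ x≡0 → inj₁ (trans X≡ (cong (_* g) x≡0))) , (λ y≡0 → inj₂ (trans Y≡ (cong (_* g) y≡0))) ]′
      (sextic-trivial x y M co M≢0 Feq)
      where
      M≢0 : M ≢ 0ℤ
      M≢0 M≡0 = fifth-power≢0 N≢0 (linear₂ 1ℤ (- (g ^ 5)) eq′ (trans Feq (cong (_^ 5) M≡0)) (lemma (g ^ 5) F N))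
        where
        lemma : ∀ G F N → N ^ 5 - 0ℤ ≡ 1ℤ * (G * F - (- N) ^ 5) + - G * (F - 0ℤ ^ 5)
        lemma = solve-∀

-- The cofactor of a + b in a⁵ + b⁵ is positive definite, because its double is a sum of squares.
fifth-powers-cancel : ∀ a b → b ≢ 0ℤ → a ^ 5 + b ^ 5 ≡ 0ℤ → a + b ≡ 0ℤ
fifth-powers-cancel a b b≢0 eq = [ id , (λ q≡0 → contradiction (b≡0 q≡0) b≢0) ]′
  (≡0⊎≡0 (a + b) (a ^ 4 - a ^ 3 * b + a ^ 2 * b ^ 2 - a * b ^ 3 + b ^ 4) (linear₁ 1ℤ eq (lemma a b)))
  where
  lemma : ∀ a b → (a + b) * (a ^ 4 - a ^ 3 * b + a ^ 2 * b ^ 2 - a * b ^ 3 + b ^ 4) - 0ℤ ≡ 1ℤ * (a ^ 5 + b ^ 5 - 0ℤ)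
  lemma = solve-∀
  b≡0 : a ^ 4 - a ^ 3 * b + a ^ 2 * b ^ 2 - a * b ^ 3 + b ^ 4 ≡ 0ℤ → b ≡ 0ℤ
  b≡0 q≡0 = square-≡0 b (square-≡0 (b ^ 2) (nonneg-sum (square-nonneg (b ^ 2))
    (nonneg-+ (square-nonneg (a ^ 2)) (nonneg-+ (square-nonneg (a ^ 2 - a * b)) (square-nonneg (a * b - b ^ 2))))
    (linear₁ (+ 2) q≡0 (sos a b))))
    where
    sos : ∀ a b → (b ^ 2) ^ 2 + ((a ^ 2) ^ 2 + ((a ^ 2 - a * b) ^ 2 + (a * b - b ^ 2) ^ 2)) - 0ℤ ≡
      + 2 * (a ^ 4 - a ^ 3 * b + a ^ 2 * b ^ 2 - a * b ^ 3 + b ^ 4 - 0ℤ)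
    sos = solve-∀

open import Data.Rational.Base as ℚ using (ℚ; mkℚ; ↥_; ↧_; 0ℚ; 1ℚ)
import Data.Rational.Properties as ℚ
open import Data.Rational.Unnormalised.Base using (*≡*)
import Data.Rational.Unnormalised.Properties as ℚᵘ

-- Rational points

fromℤ : ℤ → ℚ
fromℤ z = mkℚ z 0 (Coprimality.sym (Coprimality.1-coprimeTo (abs z)))

fromℤ-injective : ∀ {a b} → fromℤ a ≡ fromℤ b → a ≡ b
fromℤ-injective refl = refl

fromℤ-+ : ∀ a b → fromℤ (a + b) ≡ fromℤ a ℚ.+ fromℤ b
fromℤ-+ a b = ℚ.toℚᵘ-injective (ℚᵘ.≃-trans (*≡* (lemma a b)) (ℚᵘ.≃-sym (ℚ.toℚᵘ-homo-+ (fromℤ a) (fromℤ b))))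
  where
  lemma : ∀ a b → (a + b) * + 1 ≡ (a * + 1 + b * + 1) * + 1
  lemma = solve-∀

fromℤ-* : ∀ a b → fromℤ (a * b) ≡ fromℤ a ℚ.* fromℤ b
fromℤ-* a b = ℚ.toℚᵘ-injective (ℚᵘ.≃-trans (*≡* refl) (ℚᵘ.≃-sym (ℚ.toℚᵘ-homo-* (fromℤ a) (fromℤ b))))

numerator : ∀ x → fromℤ (↥ x) ≡ x ℚ.* fromℤ (↧ x)
numerator x@record{} = ℚ.toℚᵘ-injective (ℚᵘ.≃-trans
  (*≡* (trans (cong (↥ x *_) (ℤ.*-identityʳ (↧ x))) (sym (ℤ.*-identityʳ (↥ x * ↧ x)))))
  (ℚᵘ.≃-sym (ℚ.toℚᵘ-homo-* x (fromℤ (↧ x)))))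

ringℚ : AlmostCommutativeRing _ _
ringℚ = fromCommutativeRing ℚ.+-*-commutativeRing (λ x → dec⇒maybe (0ℚ ℚ.≟ x))

open AlmostCommutativeRing ringℚ using () renaming (_^_ to _^ℚ_)

cancelℚ : ∀ p {q r} → p ≢ 0ℚ → p ℚ.* q ≡ p ℚ.* r → q ≡ r
cancelℚ p {q} {r} p≢0 eq = begin
  q                      ≡⟨ ℚ.*-identityˡ q ⟨
  1ℚ ℚ.* q               ≡⟨ cong (ℚ._* q) (ℚ.*-inverseˡ p) ⟨
  (ℚ.1/ p) ℚ.* p ℚ.* q   ≡⟨ ℚ.*-assoc (ℚ.1/ p) p q ⟩
  (ℚ.1/ p) ℚ.* (p ℚ.* q) ≡⟨ cong ((ℚ.1/ p) ℚ.*_) eq ⟩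
  (ℚ.1/ p) ℚ.* (p ℚ.* r) ≡⟨ ℚ.*-assoc (ℚ.1/ p) p r ⟨
  (ℚ.1/ p) ℚ.* p ℚ.* r   ≡⟨ cong (ℚ._* r) (ℚ.*-inverseˡ p) ⟩
  1ℚ ℚ.* r               ≡⟨ ℚ.*-identityˡ r ⟩
  r                      ∎
  where
  open ≡-Reasoning
  instance _ = ℚ.≢-nonZero p≢0

record CommonDenominator (x y : ℚ) : Set where
  constructor common
  field
    X Y N : ℤ
    N≢0   : N ≢ 0ℤ
    X≡    : fromℤ X ≡ x ℚ.* fromℤ N
    Y≡    : fromℤ Y ≡ y ℚ.* fromℤ N

commonDenominator : ∀ x y → CommonDenominator x y
commonDenominator x@record{} y@record{} = common (↥ x * ↧ y) (↥ y * ↧ x) (↧ x * ↧ y) (λ ())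
  (trans (fromℤ-* (↥ x) (↧ y)) (trans (cong (ℚ._* fromℤ (↧ y)) (numerator x))
    (trans (ℚ.*-assoc x (fromℤ (↧ x)) (fromℤ (↧ y))) (cong (x ℚ.*_) (sym (fromℤ-* (↧ x) (↧ y)))))))
  (trans (fromℤ-* (↥ y) (↧ x)) (trans (cong (ℚ._* fromℤ (↧ x)) (numerator y))
    (trans (ℚ.*-assoc y (fromℤ (↧ y)) (fromℤ (↧ x))) (cong (y ℚ.*_)
      (trans (ℚ.*-comm (fromℤ (↧ y)) (fromℤ (↧ x))) (sym (fromℤ-* (↧ x) (↧ y))))))))

sextic : ℚ → ℚ → ℚ
sextic x y = (x ℚ.+ y) ℚ.* (x ^ℚ 4 ℚ.+ x ^ℚ 2 ℚ.* y ^ℚ 2 ℚ.+ y ^ℚ 4) ℚ.+ 1ℚ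

sexticℤ : ℤ → ℤ → ℤ → ℤ
sexticℤ X Y N = (X + Y) * (X ^ 4 + X ^ 2 * Y ^ 2 + Y ^ 4) + N ^ 5

fromℤ-^ : ∀ a n → fromℤ (a ^ suc n) ≡ fromℤ a ^ℚ suc n
fromℤ-^ a zero    = refl
fromℤ-^ a (suc n) = trans (fromℤ-* (a ^ suc n) a) (cong (ℚ._* fromℤ a) (fromℤ-^ a n))

fromℤ-sextic : ∀ X Y N → fromℤ (sexticℤ X Y N) ≡
  (fromℤ X ℚ.+ fromℤ Y) ℚ.* (fromℤ X ^ℚ 4 ℚ.+ fromℤ X ^ℚ 2 ℚ.* fromℤ Y ^ℚ 2 ℚ.+ fromℤ Y ^ℚ 4) ℚ.+ fromℤ N ^ℚ 5
fromℤ-sextic X Y N =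
  trans (fromℤ-+ ((X + Y) * (X ^ 4 + X ^ 2 * Y ^ 2 + Y ^ 4)) (N ^ 5)) (cong₂ ℚ._+_
    (trans (fromℤ-* (X + Y) (X ^ 4 + X ^ 2 * Y ^ 2 + Y ^ 4)) (cong₂ ℚ._*_ (fromℤ-+ X Y)
      (trans (fromℤ-+ (X ^ 4 + X ^ 2 * Y ^ 2) (Y ^ 4)) (cong₂ ℚ._+_
        (trans (fromℤ-+ (X ^ 4) (X ^ 2 * Y ^ 2)) (cong₂ ℚ._+_ (fromℤ-^ X 3)
          (trans (fromℤ-* (X ^ 2) (Y ^ 2)) (cong₂ ℚ._*_ (fromℤ-^ X 1) (fromℤ-^ Y 1)))))
        (fromℤ-^ Y 3)))))
    (fromℤ-^ N 4))

clear-denominators : ∀ {x y} (d : CommonDenominator x y) → sextic x y ≡ 0ℚ →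
  sexticℤ (CommonDenominator.X d) (CommonDenominator.Y d) (CommonDenominator.N d) ≡ 0ℤ
clear-denominators {x} {y} (common X Y N N≢0 X≡ Y≡) eq = fromℤ-injective (begin
  fromℤ (sexticℤ X Y N)           ≡⟨ fromℤ-sextic X Y N ⟩
  homogeneous (fromℤ X) (fromℤ Y) ≡⟨ cong₂ homogeneous X≡ Y≡ ⟩
  homogeneous (x ℚ.* n) (y ℚ.* n) ≡⟨ lemma x y n ⟩
  n ^ℚ 5 ℚ.* sextic x y           ≡⟨ cong (n ^ℚ 5 ℚ.*_) eq ⟩
  n ^ℚ 5 ℚ.* 0ℚ                   ≡⟨ ℚ.*-zeroʳ (n ^ℚ 5) ⟩
  0ℚ                              ∎)
  where
  open ≡-Reasoning
  n : ℚ
  n = fromℤ N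
  homogeneous : ℚ → ℚ → ℚ
  homogeneous x y = (x ℚ.+ y) ℚ.* (x ^ℚ 4 ℚ.+ x ^ℚ 2 ℚ.* y ^ℚ 2 ℚ.+ y ^ℚ 4) ℚ.+ n ^ℚ 5
  lemma : ∀ x y n → (x ℚ.* n ℚ.+ y ℚ.* n) ℚ.* ((x ℚ.* n) ^ℚ 4 ℚ.+ (x ℚ.* n) ^ℚ 2 ℚ.* (y ℚ.* n) ^ℚ 2 ℚ.+ (y ℚ.* n) ^ℚ 4)
    ℚ.+ n ^ℚ 5 ≡ n ^ℚ 5 ℚ.* ((x ℚ.+ y) ℚ.* (x ^ℚ 4 ℚ.+ x ^ℚ 2 ℚ.* y ^ℚ 2 ℚ.+ y ^ℚ 4) ℚ.+ 1ℚ)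
  lemma = Tactic.solve-∀ ringℚ

-- When X or Y vanishes, the equation collapses to a sum of two fifth powers, which leaves only the
-- 2-cycle 0, -1 in its two orders. Both force c = -1.
sextic-solutions : ∀ x y → sextic x y ≡ 0ℚ → x ≡ 0ℚ × y ≡ ℚ.- 1ℚ ⊎ y ≡ 0ℚ × x ≡ ℚ.- 1ℚ
sextic-solutions x y eq = by-denominator (commonDenominator x y)
  where
  by-denominator : CommonDenominator x y → x ≡ 0ℚ × y ≡ ℚ.- 1ℚ ⊎ y ≡ 0ℚ × x ≡ ℚ.- 1ℚ
  by-denominator d@(common X Y N N≢0 X≡ Y≡) = [ X-zero , Y-zero ]′ (homogeneous-trivial X Y N N≢0 integral)
    where
    integral : sexticℤ X Y N ≡ 0ℤ
    integral = clear-denominators d eq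
    n : ℚ
    n = fromℤ N
    n≢0 : n ≢ 0ℚ
    n≢0 n≡0 = N≢0 (fromℤ-injective n≡0)
    vanishes : ∀ Z z → fromℤ Z ≡ z ℚ.* n → Z ≡ 0ℤ → z ≡ 0ℚ
    vanishes Z z Zeq refl = cancelℚ n n≢0 (trans (ℚ.*-comm n z) (trans (sym Zeq) (sym (ℚ.*-zeroʳ n))))
    minus-one : ∀ Z z → fromℤ Z ≡ z ℚ.* n → Z ^ 5 + N ^ 5 ≡ 0ℤ → z ≡ ℚ.- 1ℚ
    minus-one Z z Zeq Z⁵+N⁵≡0 = cancelℚ n n≢0 (begin
      n ℚ.* z                          ≡⟨ lemma n z ⟩
      (z ℚ.* n ℚ.+ n) ℚ.+ n ℚ.* ℚ.- 1ℚ ≡⟨ cong (λ t → t ℚ.+ n ℚ.+ n ℚ.* ℚ.- 1ℚ) Zeq ⟨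
      (fromℤ Z ℚ.+ n) ℚ.+ n ℚ.* ℚ.- 1ℚ ≡⟨ cong (ℚ._+ n ℚ.* ℚ.- 1ℚ) (fromℤ-+ Z N) ⟨
      fromℤ (Z + N) ℚ.+ n ℚ.* ℚ.- 1ℚ   ≡⟨ cong (λ t → fromℤ t ℚ.+ n ℚ.* ℚ.- 1ℚ) (fifth-powers-cancel Z N N≢0 Z⁵+N⁵≡0) ⟩
      0ℚ ℚ.+ n ℚ.* ℚ.- 1ℚ              ≡⟨ ℚ.+-identityˡ (n ℚ.* ℚ.- 1ℚ) ⟩
      n ℚ.* ℚ.- 1ℚ                     ∎)
      where
      open ≡-Reasoning
      lemma : ∀ n z → n ℚ.* z ≡ (z ℚ.* n ℚ.+ n) ℚ.+ n ℚ.* ℚ.- 1ℚ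
      lemma = Tactic.solve-∀ ringℚ
    X-zero : X ≡ 0ℤ → x ≡ 0ℚ × y ≡ ℚ.- 1ℚ ⊎ y ≡ 0ℚ × x ≡ ℚ.- 1ℚ
    X-zero X≡0 = inj₁ (vanishes X x X≡ X≡0 , minus-one Y y Y≡
      (linear₁ 1ℤ (trans (cong (λ X → sexticℤ X Y N) (sym X≡0)) integral) (lemma Y N)))
      where
      lemma : ∀ Y N → Y ^ 5 + N ^ 5 - 0ℤ ≡ 1ℤ * ((0ℤ + Y) * (0ℤ ^ 4 + 0ℤ ^ 2 * Y ^ 2 + Y ^ 4) + N ^ 5 - 0ℤ)
      lemma = solve-∀
    Y-zero : Y ≡ 0ℤ → x ≡ 0ℚ × y ≡ ℚ.- 1ℚ ⊎ y ≡ 0ℚ × x ≡ ℚ.- 1ℚ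
    Y-zero Y≡0 = inj₂ (vanishes Y y Y≡ Y≡0 , minus-one X x X≡
      (linear₁ 1ℤ (trans (cong (λ Y → sexticℤ X Y N) (sym Y≡0)) integral) (lemma X N)))
      where
      lemma : ∀ X N → X ^ 5 + N ^ 5 - 0ℤ ≡ 1ℤ * ((X + 0ℤ) * (X ^ 4 + X ^ 2 * 0ℤ ^ 2 + 0ℤ ^ 4) + N ^ 5 - 0ℤ)
      lemma = solve-∀

two-cycle-sextic : ∀ c x y → f6 c x ≡ y → f6 c y ≡ x → y ≢ x → sextic x y ≡ 0ℚ
two-cycle-sextic c x y fx≡y fy≡x y≢x = cancelℚ (y ℚ.- x) y-x≢0 (begin
  (y ℚ.- x) ℚ.* sextic x y                             ≡⟨ factorisation c x y ⟩
  (y ℚ.- f6 c x) ℚ.- (x ℚ.- f6 c y)                    ≡⟨ cong₂ (λ s t → (y ℚ.- s) ℚ.- (x ℚ.- t)) fx≡y fy≡x ⟩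
  (y ℚ.- y) ℚ.- (x ℚ.- x)                              ≡⟨ cong₂ ℚ._-_ (ℚ.+-inverseʳ y) (ℚ.+-inverseʳ x) ⟩
  0ℚ                                                   ≡⟨ ℚ.*-zeroʳ (y ℚ.- x) ⟨
  (y ℚ.- x) ℚ.* 0ℚ                                     ∎)
  where
  open ≡-Reasoning
  y-x≢0 : y ℚ.- x ≢ 0ℚ
  y-x≢0 eq = y≢x (trans (recover x y) (trans (cong (ℚ._+ x) eq) (ℚ.+-identityˡ x)))
    where
    recover : ∀ x y → y ≡ y ℚ.- x ℚ.+ x
    recover = Tactic.solve-∀ ringℚ
  factorisation : ∀ c x y →
    (y ℚ.- x) ℚ.* ((x ℚ.+ y) ℚ.* (x ^ℚ 4 ℚ.+ x ^ℚ 2 ℚ.* y ^ℚ 2 ℚ.+ y ^ℚ 4) ℚ.+ 1ℚ) ≡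
    (y ℚ.- (x ^ℚ 6 ℚ.+ c)) ℚ.- (x ℚ.- (y ^ℚ 6 ℚ.+ c))
  factorisation = Tactic.solve-∀ ringℚ

theorem2p4 : (c : ℚ) → c ≢ ℚ.- 1ℚ →
    (x : ℚ) → ¬ ((f6 c (f6 c x) ≡ x) × (f6 c x ≢ x))
theorem2p4 c c≢-1 x (ffx≡x , fx≢x) =
  [ x-zero , y-zero ]′ (sextic-solutions x (f6 c x) (two-cycle-sextic c x (f6 c x) refl ffx≡x fx≢x))
  where
  x-zero : x ≡ 0ℚ × f6 c x ≡ ℚ.- 1ℚ → ⊥
  x-zero (x≡0 , fx≡-1) = c≢-1 (trans (sym (ℚ.+-identityˡ c)) (trans (cong (f6 c) (sym x≡0)) fx≡-1))
  y-zero : f6 c x ≡ 0ℚ × x ≡ ℚ.- 1ℚ → ⊥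
  y-zero (fx≡0 , x≡-1) = c≢-1 (trans (sym (ℚ.+-identityˡ c)) (trans (cong (f6 c) (sym fx≡0)) (trans ffx≡x x≡-1)))
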